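{- The rank $SU^d$ on complete types can equivalently be defined as follows. For a complete type $p(x)\in S(A)$: (1) $SU^d(p)\ge 0$. (2) $SU^d(p)\ge\alpha+1$ if and only if there are some $k\ge 2$ and some cardinal $\lambda$ such that for every cardinal $\kappa$ there is a $k$-inconsistent collection of $\kappa$ many complete types $q(x)$ extending $p$ with $|dom(q)|\le\lambda$ and $SU^d(q)\ge\alpha$ for each of them. (3) For $\alpha$ a limit ordinal, $SU^d(p)\ge\alpha$ if and only if $SU^d(p)\ge\beta$ for all $\beta<\alpha$. $SU^d(p)$ is the supremum of all $\alpha$ such that $SU^d(p)\ge\alpha$, and $SU^d(p)=\infty$ if this supremum does not exist. That is, the function defined by this recursion coincides, on every complete type, with $SU^d$ defined as the foundation rank of dividing.
   Context: $T$ is a complete first-order theory with a monster model $\mathfrak C$ that is $\bar\kappa$-saturated and strongly $\bar\kappa$-homogeneous for a sufficiently large cardinal $\bar\kappa$ (e.g. strongly inaccessible). All parameter sets are small subsets of $\mathfrak C$ (cardinality $<\bar\kappa$), and the cardinals $\lambda,\kappa$ quantified over are small. Complete types are finitary; for $p\in S(A)$, $dom(p)=A$. $SU^d$ is the foundation rank of the relation $R_d$ on complete types, where for $p(x)\in S(A)$ and $q(x)\in S(B)$, $p\,R_d\,q$ iff $p\subseteq q$ and $q$ divides over $A$. Explicitly: $SU^d(p)\ge 0$; $SU^d(p)\ge\alpha+1$ iff there is $q$ with $p\,R_d\,q$ and $SU^d(q)\ge\alpha$; for limit $\alpha$, $SU^d(p)\ge\alpha$ iff $SU^d(p)\ge\beta$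 for all $\beta<\alpha$; $SU^d(p)$ is the supremum of the $\alpha$ with $SU^d(p)\ge\alpha$, or $\infty$ if there is no supremum. A collection of types is $k$-inconsistent if the union of any $k$ of its (distinct) members is inconsistent. -}

module Defs where

open import Level using (Level; _⊔_) renaming (suc to lsuc)
open import Data.Nat.Base using (ℕ; suc; _+_; _≤_)
open import Data.Fin.Base using (Fin)
open import Data.Vec.Functional using (Vector; _∷_; []; _++_)
open import Data.List.Base using (List)
open import Data.List.Relation.Unary.All using (All)
open import Data.Maybe.Base using (Maybe; just; nothing)
open import Data.Empty.Polymorphic using (⊥)
open import Data.Product.Base using (Σ; Σ-syntax; ∃; ∃-syntax; _×_; _,_; proj₁)
open import Data.Sum.Base using (_⊎_)
open import Function.Base using (_∘_)
open import Function.Bundles using (Injection; _⇔_; _↔_; Inverse)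
open import Function.Definitions using (Injective)
open import Induction.WellFounded using (WellFounded; Acc; acc)
open import Relation.Binary.Core using (Rel; _Preserves_⟶_)
open import Relation.Binary.Bundles using (Setoid)
open import Relation.Binary.Structures using (IsStrictTotalOrder)
open import Relation.Binary.PropositionalEquality using (_≡_; setoid)
open import Relation.Binary.Construct.On as On using ()
open import Relation.Nullary.Construct.Add.Supremum using (_⁺; [_]; ⊤⁺)
open import Relation.Binary.Construct.Add.Supremum.Strict
  using (_<⁺_; [_]; [_]<⊤⁺; <⁺-isStrictTotalOrder-≡)
open import Relation.Nullary.Negation using (¬_)
open import Relation.Unary using (Pred; _∈_; _⊆_; _∪_; ｛_｝; ⋃)

------------------------------------------------------------------------
-- First-order logic

-- Throughout, "small" means "of size at most that of some type in Set s".
-- The universe Set s plays the role of the strongly inaccessible cardinal κ̄: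
-- small cardinals are types κ : Set s, and the language itself is small.

record Language (s : Level) : Set (lsuc s) where
  field
    FunSym : ℕ → Set s
    RelSym : ℕ → Set s

module _ {s : Level} (L : Language s) where
  open Language L

  data Term (n : ℕ) : Set s where
    var : Fin n → Term n
    app : ∀ {k} → FunSym k → Vector (Term n) k → Term n

  -- Formula n: formulas with free variables among Fin n.  In ∀′ φ the bound
  -- variable of φ is variable zero.  The other connectives are the usual
  -- classical abbreviations.
  data Formula (n : ℕ) : Set s where
    ⊥′   : Formula n
    _≐_  : Term n → Term n → Formula n
    rel  : ∀ {k} → RelSym k → Vector (Term n) k → Formula n
    _⇒′_ : Formula n → Formula n → Formula n
    ∀′   : Formula (suc n) → Formula n

  Theory : Set (lsuc s)
  Theory = Pred (Formula 0) s

  record Structure (m : Level) : Set (s ⊔ lsuc m) where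
    field
      Carrier : Set m
      point   : Carrier
      funᴹ    : ∀ {k} → FunSym k → Vector Carrier k → Carrier
      relᴹ    : ∀ {k} → RelSym k → Vector Carrier k → Set m

module _ {s : Level} {L : Language s} where

  ¬′_ : ∀ {n} → Formula L n → Formula L n
  ¬′ φ = φ ⇒′ ⊥′

  module _ {m : Level} (M : Structure L m) where
    open Structure M

    ⟦_⟧ : ∀ {n} → Term L n → Vector Carrier n → Carrier
    ⟦ var i ⟧    v = v i
    ⟦ app f ts ⟧ v = funᴹ f (λ i → ⟦ ts i ⟧ v)

    _⊨_[_] : ∀ {n} → Formula L n → Vector Carrier n → Set m
    _⊨_[_] ⊥′         v = ⊥
    _⊨_[_] (t ≐ u)    v = ⟦ t ⟧ v ≡ ⟦ u ⟧ v
    _⊨_[_] (rel R ts) v = relᴹ R (λ i → ⟦ ts i ⟧ v)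
    _⊨_[_] (φ ⇒′ ψ)   v = _⊨_[_] φ v → _⊨_[_] ψ v
    _⊨_[_] (∀′ φ)     v = ∀ a → _⊨_[_] φ (a ∷ v)

    Models : Theory L → Set (s ⊔ m)
    Models T = ∀ {σ} → σ ∈ T → _⊨_[_] σ []

  -- Semantic consequence.  By Löwenheim–Skolem, as L is small, it is enough
  -- to consider small structures.
  _⊩_ : Theory L → Formula L 0 → Set (lsuc s)
  T ⊩ σ = (N : Structure L s) → Models N T → _⊨_[_] N σ []

  IsComplete : Theory L → Set (lsuc s)
  IsComplete T = ∀ σ → (T ⊩ σ) ⊎ (T ⊩ (¬′ σ))

------------------------------------------------------------------------
-- Types over small subsets of a structure ℭ, and the monster model

module Types {s m : Level} {L : Language s} (ℭ : Structure L m) where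
  open Structure ℭ using (funᴹ; relᴹ) renaming (Carrier to C)

  Subset : Set (lsuc m)
  Subset = Pred C m

  -- |A| ≤ κ.  Elements of A are compared by their underlying element of C,
  -- ignoring the proof of membership.
  _≼_ : Subset → Set s → Set (s ⊔ m)
  A ≼ κ = Injection (On.setoid {B = Σ C A} (setoid C) proj₁) (setoid κ)

  Small : Subset → Set (lsuc s ⊔ m)
  Small A = Σ[ κ ∈ Set s ] A ≼ κ

  _⊆ᵖ_ : ∀ {k} → Vector C k → Subset → Set m
  c ⊆ᵖ A = ∀ i → c i ∈ A

  -- φ(x,c) with x an n-tuple of variables (the first n variables of the
  -- matrix) and c a tuple of parameters from ℭ.
  record ParamFormula (n : ℕ) : Set (s ⊔ m) where
    constructor _⟨_⟩
    field
      {arity} : ℕ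
      matrix  : Formula L (n + arity)
      params  : Vector C arity
  open ParamFormula public

  _⊩ᶜ_ : ∀ {n} → Vector C n → ParamFormula n → Set m
  a ⊩ᶜ (φ ⟨ c ⟩) = _⊨_[_] ℭ φ (a ++ c)

  ¬ᶜ_ : ∀ {n} → ParamFormula n → ParamFormula n
  ¬ᶜ (φ ⟨ c ⟩) = (¬′ φ) ⟨ c ⟩

  -- Consistency with the elementary diagram of ℭ, i.e. finite
  -- satisfiability in ℭ.
  Consistent : ∀ {n ℓ} → Pred (ParamFormula n) ℓ → Set (s ⊔ m ⊔ ℓ)
  Consistent Γ = ∀ φs → All (_∈ Γ) φs → ∃[ a ] All (a ⊩ᶜ_) φs

  Implies : ∀ {n ℓ} → Pred (ParamFormula n) ℓ → ParamFormula n → Set (s ⊔ m ⊔ ℓ)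
  Implies Γ φ = ¬ Consistent (Γ ∪ ｛ ¬ᶜ φ ｝)

  -- The k sets whose union is taken have pairwise distinct indices; for an
  -- injective family this is k-inconsistency of the collection of its members.
  KInconsistent : ∀ {n i ℓ} {I : Set i} → ℕ → (I → Pred (ParamFormula n) ℓ) →
                  Set (s ⊔ m ⊔ i ⊔ ℓ)
  KInconsistent {I = I} k Γ = (ι : Fin k → I) → Injective _≡_ _≡_ ι →
                              ¬ Consistent (⋃ (Fin k) (Γ ∘ ι))

  -- The elements of S(A), A small, in n variables; A = dom.
  record CompleteType (n : ℕ) : Set (lsuc (s ⊔ m)) where
    field
      dom        : Subset
      small      : Small dom
      formulas   : Pred (ParamFormula n) m
      over-dom   : ∀ {φ} → φ ∈ formulas → params φ ⊆ᵖ dom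
      consistent : Consistent formulas
      complete   : ∀ φ → params φ ⊆ᵖ dom → φ ∈ formulas ⊎ (¬ᶜ φ) ∈ formulas
  open CompleteType public

  _⊑_ : ∀ {n} → CompleteType n → CompleteType n → Set (s ⊔ m)
  p ⊑ q = formulas p ⊆ formulas q

  -- Equality of types as sets of formulas.  It determines the domain, since
  -- a ∈ dom p iff the formula a ≐ a belongs to p.
  _≈_ : ∀ {n} → CompleteType n → CompleteType n → Set (s ⊔ m)
  p ≈ q = p ⊑ q × q ⊑ p

  -- tp(b/A) = tp(b′/A)
  SameType : ∀ {k} → Subset → Vector C k → Vector C k → Set (s ⊔ m)
  SameType {k} A b b′ = (ψ : ParamFormula k) → params ψ ⊆ᵖ A →
                        (b ⊩ᶜ ψ) ⇔ (b′ ⊩ᶜ ψ)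

  -- φ(x,b) divides over A: for some k and some (bᵢ)_{i<ω} with
  -- tp(bᵢ/A) = tp(b/A), the set {φ(x,bᵢ) : i < ω} is k-inconsistent, where
  -- instances are counted by index.
  FormulaDivides : ∀ {n} → ParamFormula n → Subset → Set (s ⊔ m)
  FormulaDivides (φ ⟨ b ⟩) A =
    ∃[ k ] Σ[ b′ ∈ (ℕ → Vector C _) ]
      (∀ i → SameType A b (b′ i)) ×
      KInconsistent k (λ i → ｛ φ ⟨ b′ i ⟩ ｝)

  Divides : ∀ {n} → CompleteType n → Subset → Set (s ⊔ m)
  Divides q A = ∃[ φ ] Implies (formulas q) φ × FormulaDivides φ A

  _Rᵈ_ : ∀ {n} → CompleteType n → CompleteType n → Set (s ⊔ m)
  p Rᵈ q = p ⊑ q × Divides q (dom p)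

  record Automorphism : Set (s ⊔ m) where
    field
      bijection : C ↔ C
    open Inverse bijection public using (to)
    field
      preserves-fun : ∀ {k} (f : Language.FunSym L k) c →
                      to (funᴹ f c) ≡ funᴹ f (to ∘ c)
      preserves-rel : ∀ {k} (R : Language.RelSym L k) c →
                      relᴹ R c ⇔ relᴹ R (to ∘ c)

  Saturated : Set (lsuc (s ⊔ m))
  Saturated = ∀ n (p : CompleteType n) →
              ∃[ a ] (∀ {φ} → φ ∈ formulas p → a ⊩ᶜ φ)

  -- Elementary maps between small subsets of ℭ, presented as pairs of small
  -- families a, b with a i ↦ b i, extend to automorphisms.
  StronglyHomogeneous : Set (lsuc s ⊔ m)
  StronglyHomogeneous =
    (I : Set s) (a b : I → C) →
    (∀ {k} (φ : Formula L k) (ι : Fin k → I) →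
       _⊨_[_] ℭ φ (a ∘ ι) ⇔ _⊨_[_] ℭ φ (b ∘ ι)) →
    Σ[ σ ∈ Automorphism ] (∀ i → Automorphism.to σ (a i) ≡ b i)

  record IsMonsterModel (T : Theory L) : Set (lsuc (s ⊔ m)) where
    field
      models              : Models ℭ T
      saturated           : Saturated
      stronglyHomogeneous : StronglyHomogeneous

------------------------------------------------------------------------
-- Ordinals and ordinal-valued ranks

-- Ordinals as order types of well-ordered sets.
record Ordinal (o : Level) : Set (lsuc o) where
  field
    Point              : Set o
    _<_                : Rel Point o
    isStrictTotalOrder : IsStrictTotalOrder _≡_ _<_
    wellFounded        : WellFounded _<_

  _⋖_ : Rel Point o
  b ⋖ a = b < a × (∀ c → c < a → ¬ (b < c))

  IsLimit : Pred Point o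
  IsLimit a = ∃[ b ] b < a × ¬ (∃[ b ] b ⋖ a)

module _ {o : Level} where
  open Ordinal

  -- For well-orders, an order embedding exists iff an embedding as an initial
  -- segment does.
  _≤ᵒ_ : Ordinal o → Ordinal o → Set o
  α ≤ᵒ β = Σ[ f ∈ (Point α → Point β) ] f Preserves _<_ α ⟶ _<_ β

  sucᵒ : Ordinal o → Ordinal o
  sucᵒ α = record
    { Point              = Point α ⁺
    ; _<_                = _<⁺_ (_<_ α)
    ; isStrictTotalOrder = <⁺-isStrictTotalOrder-≡ (_<_ α) (isStrictTotalOrder α)
    ; wellFounded        = wf
    }
    where
    below : ∀ {a} → Acc (_<_ α) a → Acc (_<⁺_ (_<_ α)) [ a ]
    below (acc rs) = acc λ { [ b<a ] → below (rs b<a) }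

    wf : WellFounded (_<⁺_ (_<_ α))
    wf [ a ] = below (wellFounded α a)
    wf ⊤⁺    = acc λ { [ a ]<⊤⁺ → below (wellFounded α a) }

-- The recursion "rank(p) ≥ 0; rank(p) ≥ α+1 iff Next (rank ≥ α) p; for limit
-- α, rank(p) ≥ α iff rank(p) ≥ β for all β < α".
module Rank {x r o : Level} {X : Set x}
            (Next : Pred X (o ⊔ r) → Pred X (o ⊔ r)) where
  open Ordinal

  -- rank(p) ≥ a, for a a point of the well-order W, regarded as the ordinal of
  -- its predecessors.  For a = 0 both conjuncts are vacuous.
  AtLeastPoint : (W : Ordinal o) {a : Point W} → Acc (_<_ W) a → Pred X (o ⊔ r)
  AtLeastPoint W {a} (acc rs) p =
    (∀ b ((b<a , _) : _⋖_ W b a) → Next (AtLeastPoint W (rs b<a)) p) ×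
    (IsLimit W a → ∀ b (b<a : _<_ W b a) → AtLeastPoint W (rs b<a) p)

  -- α is the ordinal of predecessors of the top point of α+1.
  AtLeast : X → Ordinal o → Set (o ⊔ r)
  AtLeast p α = AtLeastPoint (sucᵒ α) (wellFounded (sucᵒ α) ⊤⁺) p

  IsSupremum : X → Ordinal o → Set (lsuc o ⊔ r)
  IsSupremum p α = (∀ β → AtLeast p β → β ≤ᵒ α) ×
                   (∀ γ → (∀ β → AtLeast p β → β ≤ᵒ γ) → α ≤ᵒ γ)

  -- rank(p) = v, where nothing stands for ∞.  Suprema are taken among the
  -- ordinals of level o, so o should be large enough for all ranks < ∞
  -- of elements of X to occur; results are to be stated for all o.
  HasRank : X → Maybe (Ordinal o) → Set (lsuc o ⊔ r)
  HasRank p (just α) = IsSupremum p α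
  HasRank p nothing  = ¬ (∃[ α ] IsSupremum p α)

------------------------------------------------------------------------
-- The two ranks

module SU {s m : Level} (o : Level) {L : Language s} (ℭ : Structure L m) (n : ℕ) where
  open Types ℭ

  private
    ℓ : Level
    ℓ = o ⊔ lsuc (s ⊔ m)

  DividingExtension : Pred (CompleteType n) ℓ → Pred (CompleteType n) ℓ
  DividingExtension P p = ∃[ q ] p Rᵈ q × q ∈ P

  ManyExtensions : Pred (CompleteType n) ℓ → Pred (CompleteType n) ℓ
  ManyExtensions P p =
    ∃[ k ] 2 ≤ k × Σ[ μ ∈ Set s ] (∀ (κ : Set s) →
      Σ[ q ∈ (κ → CompleteType n) ]
        Injective _≡_ _≈_ q ×
        KInconsistent k (formulas ∘ q) ×
        (∀ i → p ⊑ q i × dom (q i) ≼ μ × q i ∈ P))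

  module Dividing = Rank {r = lsuc (s ⊔ m)} {o = o} DividingExtension
  module Counting = Rank {r = lsuc (s ⊔ m)} {o = o} ManyExtensions

{-# OPTIONS --safe #-}
module Submission where

-- The two recursions have the same clause for limits, so it is enough to
-- compare their successor clauses, for a predicate on types that is invariant
-- under automorphisms.
--
-- Let q ⊇ p divide over A = dom p through φ(x,b), with (φ(x,bⱼ)), j < ω, being
-- k-inconsistent.  For a well-ordered κ, let cᵢ realise the average, along an
-- ultrafilter on ω, of (bⱼ) over A, (bⱼ) and the earlier terms of (cᵢ).  A
-- common solution of k formulas among the φ(x,cᵢ) would, replacing terms cᵢ
-- by terms bⱼ in descending order, give one of k formulas φ(x,bⱼ).  The
-- conjugates of q under automorphisms over A that map b to cᵢ are as required;
-- since no k of them coincide, arbitrarily many distinct ones can be selected.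
--
-- Conversely, let p have sufficiently many k-inconsistent extensions, with
-- domains enumerated by a fixed set.  Colour k of them by templates of formulas
-- that witness their inconsistency, together with the template of one of the
-- types.  By the Erdős–Rado theorem there are infinitely many of them on which
-- the colouring is constant.  There the conjunction of the witnessing formulas
-- is k-inconsistent, and its parameters have the same type over dom p.

open import Defs
open import Level using (Level; _⊔_; Lift; lift; lower; 0ℓ) renaming (suc to lsuc)
open import Axiom.ExcludedMiddle using (ExcludedMiddle)
open import Axiom.Extensionality.Propositional using (Extensionality; ∀-extensionality)
open import Data.Bool.Base using (Bool; true; false)
open import Data.Empty using (⊥)
open import Data.Fin.Base as Fin using (Fin; zero; suc; toℕ; _↑ˡ_; _↑ʳ_; splitAt)
import Data.Fin.Properties as Fin
open import Data.List.Base
  using (List; []; _∷_; [_]; length; map; foldr; tabulate; lookup; applyDownFrom)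
  renaming (_++_ to _++ˡ_)
open import Data.List.Properties using (length-map; map-∘; length-tabulate; length-applyDownFrom)
open import Data.List.Membership.Propositional using () renaming (_∈_ to _∈ˡ_)
open import Data.List.Membership.Propositional.Properties using (∈-lookup; ∈-map⁻; ∈-tabulate⁻)
open import Data.List.Relation.Binary.Permutation.Propositional
  using (_↭_; prep; swap; ↭-refl; ↭-sym; ↭-trans)
open import Data.List.Relation.Binary.Permutation.Propositional.Properties
  using (All-resp-↭; ∈-resp-↭; ↭-length)
open import Data.List.Relation.Unary.All as All using (All; []; _∷_)
import Data.List.Relation.Unary.All.Properties as All
open import Data.List.Relation.Unary.AllPairs as AllPairs using (AllPairs; []; _∷_)
import Data.List.Relation.Unary.AllPairs.Properties as AllPairs
open import Data.List.Relation.Unary.Any using (here; there; index)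
open import Data.List.Relation.Unary.Unique.Propositional using (Unique)
import Data.List.Relation.Unary.Unique.Propositional.Properties as Unique
open import Data.Maybe.Base using (Maybe; just; nothing)
open import Data.Nat.Base using (ℕ; zero; suc; _+_; _≤_; _<_; z≤n; s≤s) renaming (_⊔_ to _⊔ⁿ_)
import Data.Nat.Properties as ℕ
open import Data.Product.Base using (Σ-syntax; ∃; ∃-syntax; _×_; _,_; proj₁; proj₂)
open import Data.Sum.Base using (_⊎_; inj₁; inj₂; [_,_]′)
open import Data.Sum.Properties using ([,]-map)
open import Data.Vec.Functional as Vector using (Vector; _++_)
open import Function.Base using (_∘_; id; const; flip; _on_)
open import Function.Bundles using (Injection; Inverse; _⇔_; mk⇔; Equivalence)
open import Function.Definitions using (Injective)
open import Induction.WellFounded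
  using (WellFounded; Acc; acc; wf⇒asym; module FixPoint) renaming (module All to WF)
open import Relation.Binary.Core using (Rel)
import Relation.Binary.Construct.On as On
open import Relation.Binary.Definitions using (Symmetric; Transitive; Tri; tri<; tri≈; tri>)
open import Relation.Binary.PropositionalEquality hiding ([_])
open import Relation.Binary.Structures using (IsStrictTotalOrder)
open import Relation.Nullary.Decidable using (Dec; yes; no; does; decidable-stable)
open import Relation.Nullary.Negation using (¬_; contradiction)
open import Relation.Unary using (Pred; _∈_; _⊆_; _∪_; ｛_｝; ⋃)

-- Ranks of trees

data Tree (s : Level) : Set (lsuc s) where
  sup : (I : Set s) → (I → Tree s) → Tree s

-- Comparison of ranks, where the rank of sup I f is the least ordinal above
-- the ranks of the f i.
mutual
  data _≤ᵗ_ {s : Level} : Tree s → Tree s → Set (lsuc s) where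
    lim : ∀ {I f w} → (∀ i → f i <ᵗ w) → sup I f ≤ᵗ w

  data _<ᵗ_ {s : Level} : Tree s → Tree s → Set (lsuc s) where
    child : ∀ {J v} {g : J → Tree s} j → v ≤ᵗ g j → v <ᵗ sup J g

module _ {s : Level} where
  private variable
    t u v w : Tree s

  <⇒≤ᵗ : v <ᵗ w → v ≤ᵗ w
  <⇒≤ᵗ (child j (lim p)) = lim λ i → child j (<⇒≤ᵗ (p i))

  ≤-reflᵗ : ∀ (v : Tree s) → v ≤ᵗ v
  ≤-reflᵗ (sup I f) = lim λ i → child i (≤-reflᵗ (f i))

  mutual
    ≤-transᵗ : u ≤ᵗ v → v ≤ᵗ w → u ≤ᵗ w
    ≤-transᵗ (lim p) q = lim λ i → <-≤-transᵗ (p i) q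

    <-≤-transᵗ : u <ᵗ v → v ≤ᵗ w → u <ᵗ w
    <-≤-transᵗ (child j p) (lim q) = ≤-<-transᵗ p (q j)

    ≤-<-transᵗ : u ≤ᵗ v → v <ᵗ w → u <ᵗ w
    ≤-<-transᵗ p (child k q) = child k (≤-transᵗ p q)

  <-transᵗ : u <ᵗ v → v <ᵗ w → u <ᵗ w
  <-transᵗ p q = <-≤-transᵗ p (<⇒≤ᵗ q)

  <ᵗ-wellFounded : WellFounded (_<ᵗ_ {s})
  <ᵗ-wellFounded v = below v (≤-reflᵗ v)
    where
    -- Trees of equal rank may differ, so the claim is generalised to all `u` of rank at most that
    -- of `w`; the recursion is then structural in `w`.
    below : ∀ w {u} → u ≤ᵗ w → Acc _<ᵗ_ u
    below (sup J g) u≤w = acc λ t<u → belowChild (<-≤-transᵗ t<u u≤w)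
      where
      belowChild : ∀ {t} → t <ᵗ sup J g → Acc _<ᵗ_ t
      belowChild (child j t≤gj) = below (g j) t≤gj

  <ᵗ-irrefl : {v : Tree s} → ¬ (v <ᵗ v)
  <ᵗ-irrefl p = wf⇒asym <ᵗ-wellFounded p p

-- Formulas

module _ {s : Level} {L : Language s} where

  renameᵗ : ∀ {m n} → (Fin m → Fin n) → Term L m → Term L n
  renameᵗ ρ (var i)    = var (ρ i)
  renameᵗ ρ (app f ts) = app f λ i → renameᵗ ρ (ts i)

  rename : ∀ {m n} → (Fin m → Fin n) → Formula L m → Formula L n
  rename ρ ⊥′         = ⊥′
  rename ρ (t ≐ u)    = renameᵗ ρ t ≐ renameᵗ ρ u
  rename ρ (rel R ts) = rel R λ i → renameᵗ ρ (ts i)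
  rename ρ (φ ⇒′ ψ)   = rename ρ φ ⇒′ rename ρ ψ
  rename ρ (∀′ φ)     = ∀′ (rename (Fin.lift 1 ρ) φ)

-- ParamFormula is the case that M is the monster model; the case of a small M
-- serves to compare formulas over different sets enumerated by M.
record Template {s m} (L : Language s) (M : Set m) (n : ℕ) : Set (s ⊔ m) where
  constructor _⟨_⟩ᵗ
  field
    {arity} : ℕ
    matrix  : Formula L (n + arity)
    params  : Vector M arity
open Template

module _ {s m : Level} {L : Language s} {M : Set m} where

  falsumᵗ : ∀ {n} → Template L M n
  falsumᵗ = ⊥′ ⟨ Vector.[] ⟩ᵗ

  _⇒ᵗ_ : ∀ {n} → Template L M n → Template L M n → Template L M n
  _⇒ᵗ_ {n} (_⟨_⟩ᵗ {k} φ u) (_⟨_⟩ᵗ {l} ψ v) =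
    (rename (Fin.lift n (_↑ˡ l)) φ ⇒′ rename (Fin.lift n (k ↑ʳ_)) ψ) ⟨ u ++ v ⟩ᵗ

  ¬ᵗ_ : ∀ {n} → Template L M n → Template L M n
  ¬ᵗ (φ ⟨ u ⟩ᵗ) = (¬′ φ) ⟨ u ⟩ᵗ

  _⇛_ : ∀ {n} → List (Template L M n) → Template L M n → Template L M n
  ts ⇛ t = foldr _⇒ᵗ_ t ts

  ∀ᵗ : ∀ n {j} → Template L M (n + j) → Template L M j
  ∀ᵗ zero    t          = t
  ∀ᵗ (suc n) (φ ⟨ u ⟩ᵗ) = ∀ᵗ n ((∀′ φ) ⟨ u ⟩ᵗ)

  Over : ∀ {n ℓ} → Pred M ℓ → Template L M n → Set ℓ
  Over B t = ∀ i → params t i ∈ B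

  module _ {ℓ} (B : Pred M ℓ) where

    ⇒ᵗ-over : ∀ {n} (t u : Template L M n) → Over B t → Over B u → Over B (t ⇒ᵗ u)
    ⇒ᵗ-over t u t-over u-over i with splitAt (arity t) i
    ... | inj₁ j = t-over j
    ... | inj₂ j = u-over j

    ⇛-over : ∀ {n} {ts : List (Template L M n)} (t : Template L M n) →
             All (Over B) ts → Over B t → Over B (ts ⇛ t)
    ⇛-over               t []              t-over = t-over
    ⇛-over {ts = u ∷ ts} t (u-over ∷ over) t-over =
      ⇒ᵗ-over u (ts ⇛ t) u-over (⇛-over t over t-over)

    ∀ᵗ-over : ∀ n {j} (t : Template L M (n + j)) → Over B t → Over B (∀ᵗ n t)
    ∀ᵗ-over zero    t           over = over
    ∀ᵗ-over (suc n) (φ ⟨ u ⟩ᵗ) over = ∀ᵗ-over n ((∀′ φ) ⟨ u ⟩ᵗ) over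

-- Choice, and a well-ordering of every set.

module Classical (em : ∀ {ℓ} → ExcludedMiddle ℓ) (ext : ∀ {a b} → Extensionality a b) where

  private variable
    a b ℓ ℓ′ r s : Level
    X Y : Set a

  abstract
    dne : ∀ {P : Set ℓ} → ¬ ¬ P → P
    dne = decidable-stable em

    ¬∀⇒∃¬ : ∀ {P : X → Set ℓ} → ¬ (∀ x → P x) → ∃[ x ] ¬ P x
    ¬∀⇒∃¬ ¬∀ = dne λ ¬∃ → ¬∀ λ x → dne λ ¬Px → ¬∃ (x , ¬Px)

    truth : Set ℓ → Bool
    truth P = does (em {P = P})

    truth⁺ : {P : Set ℓ} → P → truth P ≡ true
    truth⁺ {P = P} p with em {P = P}
    ... | yes _ = refl
    ... | no ¬p = contradiction p ¬p

    truth⁻ : {P : Set ℓ} → truth P ≡ true → P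
    truth⁻ {P = P} eq with yes p ← em {P = P} = p

    truth-cong : {P : Set ℓ} {Q : Set ℓ′} → (P → Q) → (Q → P) → truth P ≡ truth Q
    truth-cong {P = P} {Q = Q} f g with em {P = P} | em {P = Q}
    ... | yes _ | yes _ = refl
    ... | no _  | no _  = refl
    ... | yes p | no ¬q = contradiction (f p) ¬q
    ... | no ¬p | yes q = contradiction (g q) ¬p

    private
      pick : Y → (Y → Bool) → Y
      pick y₀ Q with em {P = ∃[ y ] Q y ≡ true}
      ... | yes (y , _) = y
      ... | no _        = y₀

      pick-spec : ∀ (y₀ : Y) (Q : Y → Bool) {y} → Q y ≡ true → Q (pick y₀ Q) ≡ true
      pick-spec y₀ Q {y} eq with em {P = ∃[ y ] Q y ≡ true}
      ... | yes (_ , eq′) = eq′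
      ... | no ∄          = contradiction (y , eq) ∄

    -- Passing through Bool makes the choice depend only on the extension of P.
    choose : Y → (Y → Set ℓ) → Y
    choose y₀ P = pick y₀ (truth ∘ P)

    choose-spec : ∀ (y₀ : Y) (P : Y → Set ℓ) → ∃ P → P (choose y₀ P)
    choose-spec y₀ P (y , Py) = truth⁻ (pick-spec y₀ (truth ∘ P) {y} (truth⁺ Py))

    choose-cong : ∀ (y₀ : Y) {P : Y → Set ℓ} {Q : Y → Set ℓ′} →
                  (∀ {y} → P y → Q y) → (∀ {y} → Q y → P y) → choose y₀ P ≡ choose y₀ Q
    choose-cong y₀ f g = cong (pick y₀) (ext λ y → truth-cong f g)

  -- By hypothesis, Q x f depends only on the values of f below x.
  module _ {_◁_ : Rel X r} (wf : WellFounded _◁_) (y₀ : Y) (Q : X → (X → Y) → Y → Set ℓ)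
           (local : ∀ {x f g} → (∀ {j} → j ◁ x → f j ≡ g j) → ∀ {y} → Q x f y → Q x g y) where
    abstract
      private
        -- Away from the predecessors of `x` the default `y₀` is used; by `local` the choice at `x`
        -- does not see these values.
        extend : ∀ {x} → (∀ {j} → j ◁ x → Y) → X → Y
        extend {x} rec j with em {P = j ◁ x}
        ... | yes j◁x = rec j◁x
        ... | no _    = y₀

        step : ∀ x → (∀ {j} → j ◁ x → Y) → Y
        step x rec = choose y₀ (Q x (extend rec))

        extend-cong : ∀ {x} {f g : ∀ {j} → j ◁ x → Y} → (∀ {j} (p : j ◁ x) → f p ≡ g p) →
                      ∀ {j} → j ◁ x → extend (λ {j} → f {j}) j ≡ extend (λ {j} → g {j}) j
        extend-cong {x} eq {j} p with em {P = j ◁ x}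
        ... | yes q = eq q
        ... | no _  = refl

        extend-at : ∀ {x} (f : X → Y) → ∀ {j} → j ◁ x → extend {x} (λ {j} _ → f j) j ≡ f j
        extend-at {x} f {j} p with em {P = j ◁ x}
        ... | yes _ = refl
        ... | no ¬p = contradiction p ¬p

        step-ext : ∀ x {f g : ∀ {j} → j ◁ x → Y} → (∀ {j} (p : j ◁ x) → f p ≡ g p) →
                   step x (λ {j} → f {j}) ≡ step x (λ {j} → g {j})
        step-ext x eq = choose-cong y₀ (local (extend-cong eq)) (local (extend-cong (sym ∘ eq)))

      wfChoose : Σ[ h ∈ (X → Y) ] (∀ x → h x ≡ choose y₀ (Q x h))
      wfChoose = h , λ x → trans (unfold-wfRec {x})
                   (choose-cong y₀ (local (extend-at h)) (local (sym ∘ extend-at h)))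
        where
        open FixPoint wf (const Y) step step-ext
        h : X → Y
        h = WF.wfRec wf _ (const Y) step

      wfChoose-spec : Σ[ h ∈ (X → Y) ] (∀ x → ∃ (Q x h) → Q x h (h x))
      wfChoose-spec = let h , eq = wfChoose in
        h , λ x e → subst (Q x h) (sym (eq x)) (choose-spec y₀ (Q x h) e)

  abstract
    wf-minimal : ∀ {_◁_ : Rel X r} → WellFounded _◁_ → (P : X → Set ℓ) → ∃ P →
                 ∃[ x ] P x × (∀ {y} → P y → ¬ (y ◁ x))
    wf-minimal {_◁_ = _◁_} wf P (x , Px) = go (wf x) Px
      where
      go : ∀ {x} → Acc _◁_ x → P x → ∃[ x ] P x × (∀ {y} → P y → ¬ (y ◁ x))
      go {x} (acc rs) Px with em {P = ∃[ y ] P y × y ◁ x}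
      ... | yes (y , Py , y◁x) = go (rs y◁x) Py
      ... | no ∄               = x , Px , λ Py y◁x → ∄ (_ , Py , y◁x)

  -- The relation lies one universe higher because it comes from comparing ranks of trees.
  record WellOrder (X : Set a) : Set (lsuc (lsuc a)) where
    infix 4 _◁_
    field
      _◁_   : Rel X (lsuc a)
      ◁-wf  : WellFounded _◁_
      ◁-sto : IsStrictTotalOrder _≡_ _◁_
    open IsStrictTotalOrder ◁-sto public using (compare) renaming (trans to ◁-trans)

  mutual
    ≮⇒≥ᵗ : ∀ (v w : Tree s) → ¬ (v <ᵗ w) → w ≤ᵗ v
    ≮⇒≥ᵗ v (sup J g) v≮w = lim λ j → ≰⇒>ᵗ v (g j) (v≮w ∘ child j)

    ≰⇒>ᵗ : ∀ (v w : Tree s) → ¬ (v ≤ᵗ w) → w <ᵗ v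
    ≰⇒>ᵗ (sup I f) w v≰w =
      let i , fi≮w = ¬∀⇒∃¬ (v≰w ∘ lim) in child i (≮⇒≥ᵗ (f i) w fi≮w)

  wellOrderByRank : {X : Set s} (w : X → Tree s) →
                    (∀ {x y} → w x ≤ᵗ w y → w y ≤ᵗ w x → x ≡ y) → WellOrder X
  wellOrderByRank {X = X} w w-injective = record
    { _◁_   = _<ᵗ_ on w
    ; ◁-wf  = On.wellFounded w <ᵗ-wellFounded
    ; ◁-sto = record
      { isStrictPartialOrder = record
        { isEquivalence = isEquivalence
        ; irrefl        = λ { refl → <ᵗ-irrefl }
        ; trans         = <-transᵗ
        ; <-resp-≈      = (λ { refl → id }) , (λ { refl → id })
        }
      ; compare = λ x y → compare x y em em
      }
    }
    where
    compare : ∀ x y → Dec (w x <ᵗ w y) → Dec (w y <ᵗ w x) → Tri (w x <ᵗ w y) (x ≡ y) (w y <ᵗ w x)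
    compare x y (yes p) (yes q) = contradiction (<-transᵗ p q) <ᵗ-irrefl
    compare x y (yes p) (no ¬q) = tri< p (λ { refl → ¬q p }) ¬q
    compare x y (no ¬p) (yes q) = tri> ¬p (λ { refl → ¬p q }) q
    compare x y (no ¬p) (no ¬q) =
      tri≈ ¬p (w-injective (≮⇒≥ᵗ (w y) (w x) ¬q) (≮⇒≥ᵗ (w x) (w y) ¬p)) ¬q

  -- Choosing for each tree v an element not chosen at any tree of smaller
  -- rank exhausts X: the supremum of the trees at which the elements of X
  -- are chosen would have no room for a new value.
  rank : {X : Set s} → X → Σ[ w ∈ (X → Tree s) ] (∀ {x y} → w x ≤ᵗ w y → w y ≤ᵗ w x → x ≡ y)
  rank {s} {X} x₀ = w , w-injective
    where
    New : Tree s → (Tree s → X) → X → Set (lsuc s)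
    New v f x = ∀ {u} → u <ᵗ v → f u ≢ x

    local : ∀ {v f g} → (∀ {u} → u <ᵗ v → f u ≡ g u) → ∀ {x} → New v f x → New v g x
    local eq new u<v gu≡x = new u<v (trans (eq u<v) gu≡x)

    chosen : Σ[ g ∈ (Tree s → X) ] (∀ v → g v ≡ choose x₀ (New v g))
    chosen = wfChoose <ᵗ-wellFounded x₀ New local

    g = proj₁ chosen

    g-surjective : ∀ x → ∃[ v ] g v ≡ x
    g-surjective x = dne λ ∄ →
      let g-new : ∀ v → New v g (g v)
          g-new v = subst (New v g) (sym (proj₂ chosen v))
                      (choose-spec x₀ (New v g) (x , λ _ eq → ∄ (_ , eq)))
          t : X → Tree s
          t y = choose (sup X λ _ → sup (Lift s ⊥) λ ()) (λ v → g v ≡ y)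
          v = sup X t
      in g-new v (child (g v) (≤-reflᵗ (t (g v)))) (choose-spec _ (λ u → g u ≡ g v) (v , refl))

    w : X → Tree s
    w x = proj₁ (g-surjective x)

    -- Trees of equal rank have the same trees below them, hence equivalent predicates `New`, and
    -- `choose` depends only on the extension of its predicate.
    w-injective : ∀ {x y} → w x ≤ᵗ w y → w y ≤ᵗ w x → x ≡ y
    w-injective {x} {y} p q = begin
      x                          ≡⟨ proj₂ (g-surjective x) ⟨
      g (w x)                    ≡⟨ proj₂ chosen (w x) ⟩
      choose x₀ (New (w x) g)    ≡⟨ choose-cong x₀ (λ n u<y → n (<-≤-transᵗ u<y q))
                                                    (λ n u<x → n (<-≤-transᵗ u<x p)) ⟩
      choose x₀ (New (w y) g)    ≡⟨ proj₂ chosen (w y) ⟨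
      g (w y)                    ≡⟨ proj₂ (g-surjective y) ⟩
      y                          ∎
      where open ≡-Reasoning

  abstract
    wellOrder : (X : Set s) → WellOrder X
    wellOrder {s} X = order em
      where
      order : Dec X → WellOrder X
      order (yes x₀) = let w , w-injective = rank x₀ in wellOrderByRank w w-injective
      order (no ¬x)  = wellOrderByRank (λ _ → sup X λ x → contradiction x ¬x)
                                       (λ {x} → contradiction x ¬x)

  -- Infinite combinatorics

  -- `D` is the diagonal set of all values `f g` lying outside `g`. Types of the form `Y → Bool`
  -- take the place of successor cardinals, and this lemma says that they are larger.
  cantor : (f : (X → Bool) → X) → ¬ Injective _≡_ _≡_ f
  cantor {X = X} f f-inj = out (truth⁺ (D , refl , out))
    where
    P : X → Set _
    P x = Σ[ g ∈ (X → Bool) ] f g ≡ x × g x ≢ true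
    D : X → Bool
    D x = truth (P x)
    out : D (f D) ≢ true
    out eq with truth⁻ {P = P (f D)} eq
    ... | g , fg≡fD , g≢ = g≢ (subst (λ g → g (f D) ≡ true) (sym (f-inj fg≡fD)) eq)

  Descending : Rel X r → List X → Set _
  Descending _<_ = AllPairs (flip _<_)

  module _ {_<_ : Rel X r} (sto : IsStrictTotalOrder _≡_ _<_) where
    open IsStrictTotalOrder sto using (compare) renaming (trans to <-trans)

    insert : ∀ x {l} → Descending _<_ l → All (x ≢_) l → ∃[ l′ ] Descending _<_ l′ × l′ ↭ x ∷ l
    insert x [] [] = [ x ] , [] ∷ [] , ↭-refl
    insert x {y ∷ l} (l<y ∷ d) (x≢y ∷ x∉l) with compare x y
    ... | tri< x<y _ _ = let l′ , d′ , p = insert x d x∉l in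
      y ∷ l′ , All-resp-↭ (↭-sym p) (x<y ∷ l<y) ∷ d′ , ↭-trans (prep y p) (swap y x ↭-refl)
    ... | tri≈ _ x≡y _ = contradiction x≡y x≢y
    ... | tri> _ _ y<x =
      x ∷ y ∷ l , (y<x ∷ All.map (λ z<y → <-trans z<y y<x) l<y) ∷ l<y ∷ d , ↭-refl

    sortDescending : ∀ {l} → Unique l → ∃[ l′ ] Descending _<_ l′ × l′ ↭ l
    sortDescending [] = [] , [] , ↭-refl
    sortDescending (x∉l ∷ u) =
      let l′ , d , p   = sortDescending u
          l″ , d′ , p′ = insert _ d (All-resp-↭ (↭-sym p) x∉l)
      in l″ , d′ , ↭-trans p′ (prep _ p)

    maximum : ∀ x l → ∃[ z ] z ∈ˡ x ∷ l × All (λ y → y ≡ z ⊎ y < z) (x ∷ l)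
    maximum x [] = x , here refl , inj₁ refl ∷ []
    maximum x (y ∷ l) with maximum y l
    ... | z , z∈ , l≤z with compare x z
    ...   | tri< x<z _ _ = z , there z∈ , inj₂ x<z ∷ l≤z
    ...   | tri≈ _ x≡z _ = z , there z∈ , inj₁ x≡z ∷ l≤z
    ...   | tri> _ _ z<x = x , here refl , inj₁ refl ∷
      All.map (λ { (inj₁ refl) → inj₂ z<x ; (inj₂ y<z) → inj₂ (<-trans y<z z<x) }) l≤z

  uniqueOrComplete : ∀ (P : Pred X ℓ) n → (∃[ l ] Unique l × All P l × length l ≡ n) ⊎
                                          (∃[ l ] (∀ {x} → P x → x ∈ˡ l))
  uniqueOrComplete P zero = inj₁ ([] , [] , [] , refl)
  uniqueOrComplete P (suc n) with uniqueOrComplete P n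
  ... | inj₂ complete = inj₂ complete
  ... | inj₁ (l , u , Pl , len) with em {P = ∃[ x ] P x × ¬ (x ∈ˡ l)}
  ...   | yes (x , Px , x∉l) = inj₁ (x ∷ l , All.¬Any⇒All¬ l x∉l ∷ u , Px ∷ Pl , cong suc len)
  ...   | no ∄ = inj₂ (l , λ Px → dne λ x∉l → ∄ (_ , Px , x∉l))

  index-injective : ∀ {l : List X} {x y} (p : x ∈ˡ l) (q : y ∈ˡ l) → index p ≡ index q → x ≡ y
  index-injective (here refl) (here refl) _ = refl
  index-injective (there p) (there q) eq = index-injective p q (Fin.suc-injective eq)

  -- If no fibre had `n` distinct elements, every fibre would be listed by a finite list. Coding `g`
  -- by its value and its position in that list would then embed the power set of `X × ℕ` in
  -- `X × ℕ`; this is where the factor `ℕ` is used.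
  pigeonhole : ∀ (f : ((X × ℕ) → Bool) → X) n →
               ∃[ x ] ∃[ l ] Unique l × All (λ g → f g ≡ x) l × length l ≡ n
  pigeonhole {X = X} f n = dne λ ∄ →
    let fibre : ∀ x → ∃[ l ] (∀ {g} → f g ≡ x → g ∈ˡ l)
        fibre x = [ (λ e → contradiction (x , e) ∄) , id ]′ (uniqueOrComplete (λ g → f g ≡ x) n)
        code : ((X × ℕ) → Bool) → X × ℕ
        code g = f g , toℕ (index (proj₂ (fibre (f g)) refl))
        transport : ∀ {x y g} (p : f g ≡ x) → x ≡ y →
          ∃[ q ] toℕ (index (proj₂ (fibre x) {g} p)) ≡ toℕ (index (proj₂ (fibre y) {g} q))
        transport = λ { p refl → p , refl }
        code-injective : Injective _≡_ _≡_ code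
        code-injective {g} {h} eq =
          let q , eq′ = transport {g = h} refl (sym (cong proj₁ eq)) in
          index-injective _ _ (Fin.toℕ-injective (trans (cong proj₂ eq) eq′))
    in cantor code code-injective

  -- If every x were related to an earlier choice, the map taking x to that
  -- choice would have K elements of a single class in one fibre.
  unrelated : {κ : Set s} (R : Rel ((κ × ℕ) → Bool) ℓ) → Symmetric R → ∀ K →
              (∀ {x l} → Unique l → All (λ y → R y x) l → length l ≢ K) →
              Σ[ g ∈ (κ → (κ × ℕ) → Bool) ] (∀ {i j} → R (g i) (g j) → i ≡ j)
  unrelated {κ = κ} R R-sym K small = g , g-unrelated
    where
    open WellOrder (wellOrder κ)

    Q : κ → (κ → (κ × ℕ) → Bool) → ((κ × ℕ) → Bool) → Set _
    Q i g x = ∀ {j} → j ◁ i → ¬ R x (g j)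

    g-spec : Σ[ g ∈ (κ → (κ × ℕ) → Bool) ] (∀ i → ∃ (Q i g) → Q i g (g i))
    g-spec = wfChoose-spec ◁-wf (λ _ → true) Q
      (λ eq q j◁i Rx → q j◁i (subst (R _) (sym (eq j◁i)) Rx))

    g = proj₁ g-spec

    g-new : ∀ i → Q i g (g i)
    g-new i = proj₂ g-spec i (dne λ ∄ →
      let blocked : ∀ x → ∃[ j ] R x (g j)
          blocked x = dne λ free → ∄ (x , λ {j} _ Rx → free (j , Rx))
          j , l , u , fl , len = pigeonhole (proj₁ ∘ blocked) K
      in small u (All.map (λ {x} eq → subst (λ j → R x (g j)) eq (proj₂ (blocked x))) fl) len)

    g-unrelated : ∀ {i j} → R (g i) (g j) → i ≡ j
    g-unrelated {i} {j} Rij with compare i j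
    ... | tri< i◁j _ _ = contradiction (R-sym Rij) (g-new j i◁j)
    ... | tri≈ _ i≡j _ = i≡j
    ... | tri> _ _ j◁i = contradiction Rij (g-new i j◁i)

  -- The intersection of the listed sets is infinite. Asking for this instead of nonemptiness makes
  -- the ultrafilter below nonprincipal.
  Unbounded : List (ℕ → Bool) → Set
  Unbounded l = ∀ N → ∃[ j ] N ≤ j × All (λ S → S j ≡ true) l

  ultrafilter : Σ[ U ∈ Pred (ℕ → Bool) 0ℓ ]
                  (∀ {l} → All U l → Unbounded l) ×
                  (∀ {S S′} → (∀ j → S j ≡ false → S′ j ≡ true) → U S ⊎ U S′)
  ultrafilter = U , unbounded , ultra
    where
    open WellOrder (wellOrder (ℕ → Bool))

    Compatible : (ℕ → Bool) → ((ℕ → Bool) → Bool) → Set _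
    Compatible S f = ∀ {l} → All (λ S′ → S′ ◁ S × f S′ ≡ true) l → Unbounded (S ∷ l)

    Q : (ℕ → Bool) → ((ℕ → Bool) → Bool) → Bool → Set _
    Q S f b = (b ≡ true → Compatible S f) × (Compatible S f → b ≡ true)

    compatible-local : ∀ {S f g} → (∀ {S′} → S′ ◁ S → f S′ ≡ g S′) → Compatible S f → Compatible S g
    compatible-local eq c = c ∘ All.map (λ { (p , q) → p , trans (eq p) q })

    u-spec : Σ[ u ∈ ((ℕ → Bool) → Bool) ] (∀ S → ∃ (Q S u) → Q S u (u S))
    u-spec = wfChoose-spec ◁-wf true Q λ eq (p , q) →
      compatible-local eq ∘ p , q ∘ compatible-local (sym ∘ eq)

    u = proj₁ u-spec

    u-compatible : ∀ S → Q S u (u S)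
    u-compatible S = proj₂ u-spec S (truth (Compatible S u) , truth⁻ , truth⁺)

    U : Pred (ℕ → Bool) 0ℓ
    U S = u S ≡ true

    -- Copies of the maximum `z` are removed from the list, so that compatibility of `z` with the
    -- earlier members can be applied to the rest.
    below : ∀ {z l} → All (λ y → y ≡ z ⊎ y ◁ z) l → All U l →
            ∃[ l′ ] All (λ y → y ◁ z × U y) l′ ×
                    (∀ {P : Pred (ℕ → Bool) 0ℓ} → P z → All P l′ → All P l)
    below [] [] = [] , [] , λ _ _ → []
    below (inj₁ refl ∷ l≤z) (_ ∷ Ul) = let l′ , b , k = below l≤z Ul in l′ , b , λ Pz Pl → Pz ∷ k Pz Pl
    below (inj₂ y◁z ∷ l≤z) (Uy ∷ Ul) = let l′ , b , k = below l≤z Ul in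
      _ ∷ l′ , (y◁z , Uy) ∷ b , λ { Pz (Py ∷ Pl) → Py ∷ k Pz Pl }

    unbounded : ∀ {l} → All U l → Unbounded l
    unbounded {[]} _ N = N , ℕ.≤-refl , []
    unbounded {x ∷ l} Ul N =
      let z , z∈ , l≤z  = maximum ◁-sto x l
          l′ , b , k    = below l≤z Ul
          j , N≤j , zlj = proj₁ (u-compatible z) (All.lookup Ul z∈) b N
      in j , N≤j , k (All.head zlj) (All.tail zlj)

    incompatible : ∀ {S} → ¬ U S → ∃[ l ] All U l ×
                   ∃[ N ] (∀ {j} → N ≤ j → All (λ S → S j ≡ true) l → S j ≡ false)
    incompatible {S} ¬US = dne λ ∄ → ¬US (proj₂ (u-compatible S) λ {l} Ul N →
      dne λ ∄j → ∄ (l , All.map proj₂ Ul , N , λ {j} N≤j lj →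
        ≢true λ Sj → ∄j (j , N≤j , Sj ∷ lj)))
      where
      ≢true : ∀ {b} → b ≢ true → b ≡ false
      ≢true {false} _ = refl
      ≢true {true}  ne = contradiction refl ne

    ultra : ∀ {S S′} → (∀ j → S j ≡ false → S′ j ≡ true) → U S ⊎ U S′
    ultra {S} {S′} cover with em {P = U S} | em {P = U S′}
    ... | yes US | _       = inj₁ US
    ... | no _   | yes US′ = inj₂ US′
    -- Beyond both bounds, the members of `U` that reject the two sets have a common element, which
    -- would lie in neither set although they cover ω.
    ... | no ¬US | no ¬US′ =
      let l , Ul , N , f     = incompatible ¬US
          l′ , Ul′ , N′ , f′ = incompatible ¬US′
          j , NN≤j , all     = unbounded (All.++⁺ Ul Ul′) (N ⊔ⁿ N′)
          S′j = cover j (f (ℕ.m⊔n≤o⇒m≤o N N′ NN≤j) (All.++⁻ˡ l all))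
      in contradiction (trans (sym S′j) (f′ (ℕ.m⊔n≤o⇒n≤o N N′ NN≤j) (All.++⁻ʳ l all))) λ ()

  stepwise : ∀ {R : Rel X r} → Transitive R → (f : ℕ → X) → (∀ j → R (f j) (f (suc j))) →
             ∀ {i j} → i < j → R (f i) (f j)
  stepwise {R = R} R-trans f step {i} {suc j} (s≤s i≤j) with ℕ.m≤n⇒m<n∨m≡n i≤j
  ... | inj₁ i<j  = R-trans (stepwise {R = R} R-trans f step i<j) (step j)
  ... | inj₂ refl = step j

  -- Each index is taken beyond the previous one so that its value under `h` is least on the
  -- remaining tail; tails shrink, so the least values grow.
  increasingSubsequence : (W : WellOrder X) (h : ℕ → X) → Injective _≡_ _≡_ h →
    Σ[ g ∈ (ℕ → ℕ) ] (∀ {i j} → i < j → g i < g j) ×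
                     (∀ {i j} → i < j → WellOrder._◁_ W (h (g i)) (h (g j)))
  increasingSubsequence W h h-inj = g , g-mono , hg-mono
    where
    open WellOrder W

    least : ∀ N → ∃[ n ] N ≤ n × (∀ {m} → N ≤ m → ¬ (h m ◁ h n))
    least N = wf-minimal (On.wellFounded h ◁-wf) (N ≤_) (N , ℕ.≤-refl)

    start g : ℕ → ℕ
    start zero    = zero
    start (suc j) = suc (g j)
    g j = proj₁ (least (start j))

    g-mono : ∀ {i j} → i < j → g i < g j
    g-mono = stepwise {R = _<_} ℕ.<-trans g (λ j → proj₁ (proj₂ (least (suc (g j)))))

    ≮⇒◁ : ∀ {m n} → m < n → ¬ (h n ◁ h m) → h m ◁ h n
    ≮⇒◁ {m} {n} m<n ≮ with compare (h m) (h n)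
    ... | tri< p _ _  = p
    ... | tri≈ _ eq _ = contradiction (h-inj eq) (ℕ.<⇒≢ m<n)
    ... | tri> _ _ p  = contradiction p ≮

    hg-mono : ∀ {i j} → i < j → h (g i) ◁ h (g j)
    hg-mono = stepwise {R = _◁_} ◁-trans (h ∘ g) λ j →
      let _ , start≤g , minimal = least (start j)
          g<g                   = g-mono (ℕ.n<1+n j)
      in ≮⇒◁ g<g (minimal (ℕ.≤-trans start≤g (ℕ.<⇒≤ g<g)))

  -- The partition relation κ → (ω)ᵏ with colours in Λ.
  HasHomogeneous : ℕ → Set a → Set b → Set _
  HasHomogeneous k κ Λ = (c : List κ → Λ) → Σ[ h ∈ (ℕ → κ) ] Injective _≡_ _≡_ h ×
    ∃[ γ ] (∀ {l} → Descending _<_ l → length l ≡ k → c (map h l) ≡ γ)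

  -- Induction on `k`: along an end-homogeneous sequence the colour of a list does not depend on its
  -- head, the latest term, which leaves a colouring of lists of length `k`.
  erdősRado : ∀ k (Λ : Set s) → Σ[ κ ∈ Set s ] HasHomogeneous k κ Λ
  erdősRado {s} zero Λ = Lift s ℕ , λ c → lift , cong lower , c [] , λ { {[]} _ _ → refl }
  erdősRado {s} (suc k) Λ = κ , λ c → homogeneous c (endHomogeneous c)
    where
    κ₀ = proj₁ (erdősRado k Λ)
    -- The power set of the range of `code` below, so that `code` cannot be injective.
    κ = (κ₀ × (List κ₀ → Λ)) → Bool
    open WellOrder (wellOrder κ₀)

    Next : (List κ → Λ) → κ → κ₀ → (κ₀ → κ) → κ → Set _
    Next c x i f y = (∀ {j} → j ◁ i → f j ≢ y) ×
                     (∀ {l} → All (_◁ i) l → c (y ∷ map f l) ≡ c (x ∷ map f l))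

    map-local : ∀ {i} {f g : κ₀ → κ} {l} → (∀ {j} → j ◁ i → f j ≡ g j) →
                All (_◁ i) l → map f l ≡ map g l
    map-local eq []      = refl
    map-local eq (p ∷ d) = cong₂ _∷_ (eq p) (map-local eq d)

    next-local : ∀ c {x i f g} → (∀ {j} → j ◁ i → f j ≡ g j) →
                 ∀ {y} → Next c x i f y → Next c x i g y
    next-local c eq (p , q) = (λ j◁i gj≡y → p j◁i (trans (eq j◁i) gj≡y)) ,
      λ d → subst (λ m → c (_ ∷ m) ≡ c (_ ∷ m)) (map-local eq d) (q d)

    EndHomogeneous : (List κ → Λ) → Set _
    EndHomogeneous c = ∃[ x ] Σ[ e ∈ (κ₀ → κ) ] (∀ i → Next c x i e (e i))

    -- Each x determines a path of elements with the same colours as x over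
    -- the earlier ones.  An x lying on its own path is determined by its
    -- position and by the colours, so by Cantor some x does not.
    endHomogeneous : ∀ c → EndHomogeneous c
    endHomogeneous c = dne λ ∄ →
      let hit : ∀ x → ∃[ i ] e x i ≡ x
          hit x = dne λ miss → ∄ (x , e x , λ i →
            subst (Next c x i (e x)) (sym (e-eq x i)) (choose-spec _ (Next c x i (e x))
              (x , (λ _ eq → miss (_ , eq)) , λ _ → refl)))
          code : κ → κ₀ × (List κ₀ → Λ)
          code x = proj₁ (hit x) , λ l → c (x ∷ map (e x) l)
          code-injective : Injective _≡_ _≡_ code
          code-injective {x} {y} eq =
            trans (sym (proj₂ (hit x))) (trans (cong (e x) (cong proj₁ eq))
              (trans (determined (λ l → cong (λ z → proj₂ z l) eq) (◁-wf _)) (proj₂ (hit y))))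
      in cantor code code-injective
      where
      path : ∀ x → Σ[ e ∈ (κ₀ → κ) ] (∀ i → e i ≡ choose (λ _ → true) (Next c x i e))
      path x = wfChoose ◁-wf (λ _ → true) (Next c x) (next-local c)

      e : κ → κ₀ → κ
      e x = proj₁ (path x)

      e-eq : ∀ x i → e x i ≡ choose (λ _ → true) (Next c x i (e x))
      e-eq x = proj₂ (path x)

      SameColours : Rel κ _
      SameColours x y = ∀ l → c (x ∷ map (e x) l) ≡ c (y ∷ map (e y) l)

      next-colours : ∀ {x y} → SameColours x y → ∀ {i} → (∀ {j} → j ◁ i → e x j ≡ e y j) →
                     ∀ {z} → Next c x i (e x) z → Next c y i (e y) z
      next-colours same eq q = let p , q = next-local c eq q in p , λ {l} d →
        trans (q d) (trans (cong (λ m → c (_ ∷ m)) (sym (map-local eq d))) (same l))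

      determined : ∀ {x y} → SameColours x y → ∀ {i} → Acc _◁_ i → e x i ≡ e y i
      determined {x} {y} same {i} (acc rs) = trans (e-eq x i) (trans
        (choose-cong _ (next-colours same IH) (next-colours (sym ∘ same) (sym ∘ IH)))
        (sym (e-eq y i)))
        where
        IH : ∀ {j} → j ◁ i → e x j ≡ e y j
        IH j◁i = determined same (rs j◁i)

    homogeneous : ∀ c → EndHomogeneous c →
      Σ[ h ∈ (ℕ → κ) ] Injective _≡_ _≡_ h ×
        ∃[ γ ] (∀ {l} → Descending _<_ l → length l ≡ suc k → c (map h l) ≡ γ)
    homogeneous c (x , e , next) =
      e ∘ h ∘ g , inj , γ , λ { {i ∷ l} (l<i ∷ d) len → begin
        c (map (e ∘ h ∘ g) (i ∷ l))
          ≡⟨ cong (λ m → c (e (h (g i)) ∷ m)) (maps l) ⟩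
        c (e (h (g i)) ∷ map e (map h (map g l)))
          ≡⟨ proj₂ (next _) (All.map⁺ (All.map⁺ (All.map hg-mono l<i))) ⟩
        c (x ∷ map e (map h (map g l)))
          ≡⟨ hom (AllPairs.map⁺ (AllPairs.map g-mono d))
                 (trans (length-map g l) (ℕ.suc-injective len)) ⟩
        γ ∎ }
      where
      open ≡-Reasoning
      ih = proj₂ (erdősRado k Λ) (λ l → c (x ∷ map e l))
      h = proj₁ ih
      γ = proj₁ (proj₂ (proj₂ ih))
      hom = proj₂ (proj₂ (proj₂ ih))
      -- Homogeneity of `h` refers to the order of ℕ, end-homogeneity of `e` to that of `κ₀`. On the
      -- subsequence both orders agree, so the head of a descending list is also its latest term.
      sub = increasingSubsequence (wellOrder κ₀) h (proj₁ (proj₂ ih))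
      g = proj₁ sub
      g-mono = proj₁ (proj₂ sub)
      hg-mono = proj₂ (proj₂ sub)

      maps : ∀ l → map (e ∘ h ∘ g) l ≡ map e (map h (map g l))
      maps l = trans (map-∘ l) (cong (map e) (map-∘ l))

      inj : Injective _≡_ _≡_ (e ∘ h ∘ g)
      inj {i} {j} eq with ℕ.<-cmp i j
      ... | tri< i<j _ _ = contradiction eq (proj₁ (next _) (hg-mono i<j))
      ... | tri≈ _ i≡j _ = i≡j
      ... | tri> _ _ j<i = contradiction (sym eq) (proj₁ (next _) (hg-mono j<i))

  -- Semantics of formulas

  ∘-++ : ∀ {m n} (h : X → Y) (f : Vector X m) (g : Vector X n) → h ∘ (f ++ g) ≡ (h ∘ f) ++ (h ∘ g)
  ∘-++ {m = m} h f g = ext pointwise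
    where
    pointwise : ∀ i → h ((f ++ g) i) ≡ ((h ∘ f) ++ (h ∘ g)) i
    pointwise i with splitAt m i
    ... | inj₁ _ = refl
    ... | inj₂ _ = refl

  ++-↑ˡ : ∀ {m n} (v : Vector X m) (w : Vector X n) → (v ++ w) ∘ (_↑ˡ n) ≡ v
  ++-↑ˡ {m = m} {n} v w = ext λ i → cong [ v , w ]′ (Fin.splitAt-↑ˡ m i n)

  ++-↑ʳ : ∀ {m n} (v : Vector X m) (w : Vector X n) → (v ++ w) ∘ (m ↑ʳ_) ≡ w
  ++-↑ʳ {m = m} {n} v w = ext λ i → cong [ v , w ]′ (Fin.splitAt-↑ʳ m n i)

  ++-lift : ∀ {m n k} (v : Vector X m) (w : Vector X n) (ρ : Fin k → Fin n) →
            (v ++ w) ∘ Fin.lift m ρ ≡ v ++ (w ∘ ρ)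
  ++-lift v w ρ = ext (pointwise _ v)
    where
    pointwise : ∀ m (v : Vector _ m) i → (v ++ w) (Fin.lift m ρ i) ≡ (v ++ (w ∘ ρ)) i
    pointwise zero    v i       = refl
    pointwise (suc m) v zero    = refl
    pointwise (suc m) v (suc i) = begin
      (v ++ w) (suc (Fin.lift m ρ i))   ≡⟨ [,]-map (splitAt m (Fin.lift m ρ i)) ⟩
      ((v ∘ suc) ++ w) (Fin.lift m ρ i) ≡⟨ pointwise m (v ∘ suc) i ⟩
      ((v ∘ suc) ++ (w ∘ ρ)) i          ≡⟨ [,]-map (splitAt m i) ⟨
      (v ++ (w ∘ ρ)) (suc i)            ∎
      where open ≡-Reasoning

  ∷-++ : ∀ {m n} (a : X) (v : Vector X m) (w : Vector X n) →
         (a Vector.∷ v) ++ w ≡ a Vector.∷ (v ++ w)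
  ∷-++ {m = m} a v w = ext pointwise
    where
    pointwise : ∀ i → ((a Vector.∷ v) ++ w) i ≡ (a Vector.∷ (v ++ w)) i
    pointwise zero = refl
    pointwise (suc i) with splitAt m i
    ... | inj₁ _ = refl
    ... | inj₂ _ = refl

  lookup-injective : ∀ {l : List X} → Unique l → Injective _≡_ _≡_ (lookup l)
  lookup-injective (_ ∷ _)   {zero}  {zero}  _  = refl
  lookup-injective (x∉ ∷ _)  {zero}  {suc j} eq = contradiction eq (All.lookup x∉ (∈-lookup j))
  lookup-injective (x∉ ∷ _)  {suc i} {zero}  eq = contradiction (sym eq) (All.lookup x∉ (∈-lookup i))
  lookup-injective (_ ∷ u)   {suc i} {suc j} eq = cong suc (lookup-injective u eq)

  module Logic {s m : Level} {L : Language s} (ℭ : Structure L m) where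
    open Structure ℭ using (point; funᴹ; relᴹ) renaming (Carrier to C)
    open Types ℭ

    _⊨[_] : ∀ {n} → Formula L n → Vector C n → Set m
    φ ⊨[ v ] = _⊨_[_] ℭ φ v

    ⟦renameᵗ⟧ : ∀ {j k} (ρ : Fin j → Fin k) t v → ⟦ ℭ ⟧ (renameᵗ ρ t) v ≡ ⟦ ℭ ⟧ t (v ∘ ρ)
    ⟦renameᵗ⟧ ρ (var i)    v = refl
    ⟦renameᵗ⟧ ρ (app f ts) v = cong (funᴹ f) (ext λ i → ⟦renameᵗ⟧ ρ (ts i) v)

    -- An equality of types rather than an equivalence, so that the cases of `⇒′` and `∀′` follow by
    -- congruence and extensionality.
    ⊨-rename : ∀ {j k} (ρ : Fin j → Fin k) φ v → (rename ρ φ ⊨[ v ]) ≡ (φ ⊨[ v ∘ ρ ])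
    ⊨-rename ρ ⊥′         v = refl
    ⊨-rename ρ (t ≐ u)    v = cong₂ _≡_ (⟦renameᵗ⟧ ρ t v) (⟦renameᵗ⟧ ρ u v)
    ⊨-rename ρ (rel R ts) v = cong (relᴹ R) (ext λ i → ⟦renameᵗ⟧ ρ (ts i) v)
    ⊨-rename ρ (φ ⇒′ ψ)   v = cong₂ (λ A B → A → B) (⊨-rename ρ φ v) (⊨-rename ρ ψ v)
    ⊨-rename ρ (∀′ φ)     v = ∀-extensionality ext _ _ λ a →
      trans (⊨-rename (Fin.lift 1 ρ) φ (a Vector.∷ v))
            (cong (φ ⊨[_]) (ext λ { zero → refl ; (suc _) → refl }))

    inst : ∀ {n} {M : Set a} → (M → C) → Template L M n → ParamFormula n
    inst d (φ ⟨ u ⟩ᵗ) = φ ⟨ d ∘ u ⟩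

    module _ {M : Set a} (d : M → C) where

      _⊩[_] : ∀ {n} → Vector C n → Template L M n → Set m
      v ⊩[ t ] = v ⊩ᶜ inst d t

      ⊩-⇒ᵗ : ∀ {n} (v : Vector C n) t u → (v ⊩[ t ⇒ᵗ u ]) ≡ (v ⊩[ t ] → v ⊩[ u ])
      ⊩-⇒ᵗ v (φ ⟨ u ⟩ᵗ) (ψ ⟨ w ⟩ᵗ) = cong₂ (λ A B → A → B)
        (trans (⊨-rename _ φ _) (cong (φ ⊨[_])
          (trans (++-lift v (d ∘ (u ++ w)) _) (cong (v ++_) (cong (d ∘_) (++-↑ˡ u w))))))
        (trans (⊨-rename _ ψ _) (cong (ψ ⊨[_])
          (trans (++-lift v (d ∘ (u ++ w)) _) (cong (v ++_) (cong (d ∘_) (++-↑ʳ u w))))))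

      ⊩-⇛ : ∀ {n} (v : Vector C n) ts t → v ⊩[ ts ⇛ t ] ⇔ (All (v ⊩[_]) ts → v ⊩[ t ])
      ⊩-⇛ v []       t = mk⇔ const λ f → f []
      ⊩-⇛ v (u ∷ ts) t = mk⇔
        (λ { p (q ∷ qs) → Equivalence.to (⊩-⇛ v ts t) (subst id (⊩-⇒ᵗ v u (ts ⇛ t)) p q) qs })
        (λ f → subst id (sym (⊩-⇒ᵗ v u (ts ⇛ t))) λ q →
          Equivalence.from (⊩-⇛ v ts t) λ qs → f (q ∷ qs))

      ⊩-∀ᵗ : ∀ n {j} (v : Vector C j) t → v ⊩[ ∀ᵗ n t ] ⇔ (∀ x → (x ++ v) ⊩[ t ])
      ⊩-∀ᵗ zero v t = mk⇔ (λ p x → p) (λ f → f Vector.[])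
      ⊩-∀ᵗ (suc n) v (φ ⟨ u ⟩ᵗ) = mk⇔
        (λ p x → subst (φ ⊨[_])
          (trans (sym (∷-++ (x zero) ((x ∘ suc) ++ v) (d ∘ u)))
            (cong (_++ (d ∘ u)) (trans (sym (∷-++ (x zero) (x ∘ suc) v))
              (cong (_++ v) (ext λ { zero → refl ; (suc _) → refl })))))
          (Equivalence.to IH p (x ∘ suc) (x zero)))
        (λ f → Equivalence.from IH λ x a → subst (φ ⊨[_])
          (trans (cong (_++ (d ∘ u)) (∷-++ a x v)) (∷-++ a (x ++ v) (d ∘ u)))
          (f (a Vector.∷ x)))
        where IH = ⊩-∀ᵗ n v ((∀′ φ) ⟨ u ⟩ᵗ)

    -- Finite witnesses of inconsistency and implication.

    ¬consistent⇒ : ∀ {n} {Γ : Pred (ParamFormula n) ℓ} → ¬ Consistent Γ →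
                   ∃[ φs ] All (_∈ Γ) φs × (∀ a → ¬ All (a ⊩ᶜ_) φs)
    ¬consistent⇒ inc = dne λ ∄ → inc λ φs φs⊆Γ → dne λ ∄a →
      ∄ (φs , φs⊆Γ , λ a aφs → ∄a (a , aφs))

    -- From a finite inconsistent part of Γ with ¬φ, the copies of ¬φ are dropped; the remaining
    -- formulas lie in Γ and have φ as a consequence.
    implies⇒ : ∀ {n} {Γ : Pred (ParamFormula n) ℓ} {φ} → Implies Γ φ →
               ∃[ φs ] All (_∈ Γ) φs × (∀ {a} → All (a ⊩ᶜ_) φs → a ⊩ᶜ φ)
    implies⇒ {Γ = Γ} {φ} imp =
      let φs , φs⊆ , inc = ¬consistent⇒ imp
          ψs , ψs⊆ , k   = drop φs φs⊆
      in ψs , ψs⊆ , λ {a} aψs → dne λ ¬φ → inc a (k aψs λ p → contradiction p ¬φ)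
      where
      drop : ∀ φs → All (_∈ Γ ∪ ｛ ¬ᶜ φ ｝) φs →
             ∃[ ψs ] All (_∈ Γ) ψs × (∀ {a} → All (a ⊩ᶜ_) ψs → a ⊩ᶜ (¬ᶜ φ) → All (a ⊩ᶜ_) φs)
      drop [] [] = [] , [] , λ _ _ → []
      drop (φ ∷ φs) (inj₁ φ∈ ∷ φs⊆) = let ψs , ψs⊆ , k = drop φs φs⊆ in
        φ ∷ ψs , φ∈ ∷ ψs⊆ , λ { (p ∷ ps) q → p ∷ k ps q }
      drop (_ ∷ φs) (inj₂ refl ∷ φs⊆) = let ψs , ψs⊆ , k = drop φs φs⊆ in
        ψs , ψs⊆ , λ ps q → q ∷ k ps q

    ⇒implies : ∀ {n} {Γ : Pred (ParamFormula n) ℓ} {φ} →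
               ∀ φs → All (_∈ Γ) φs → (∀ {a} → All (a ⊩ᶜ_) φs → a ⊩ᶜ φ) → Implies Γ φ
    ⇒implies {φ = φ} φs φs⊆ k con with con ((¬ᶜ φ) ∷ φs) (inj₂ refl ∷ All.map inj₁ φs⊆)
    ... | a , a¬φ ∷ aφs = lower (a¬φ (k aφs))

    kInconsistent⇒ : ∀ {n k} {I : Set a} {Γ : I → Pred (ParamFormula n) ℓ} → KInconsistent k Γ →
                     ∀ {l} → Unique l → length l ≡ k →
                     ∃[ φs ] All (λ φ → ∃[ i ] i ∈ˡ l × φ ∈ Γ i) φs × (∀ a → ¬ All (a ⊩ᶜ_) φs)
    kInconsistent⇒ inc {l} u refl =
      let φs , φs⊆ , f = ¬consistent⇒ (inc (lookup l) (lookup-injective u)) in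
      φs , All.map (λ { (i , φ∈) → lookup l i , ∈-lookup i , φ∈ }) φs⊆ , f

    -- When the value of the variables does not matter, a formula says something about its
    -- parameters only. With `⇒sentence`, this lets a type decide which statements about elements of
    -- its domain are true in ℭ.
    sentence⇒ : ∀ {n} (q : CompleteType n) {φ} → (∀ {a b} → a ⊩ᶜ φ → b ⊩ᶜ φ) →
                φ ∈ formulas q → ∀ a → a ⊩ᶜ φ
    sentence⇒ q indep φ∈ a with consistent q (_ ∷ []) (φ∈ ∷ [])
    ... | b , bφ ∷ [] = indep bφ

    ⇒sentence : ∀ {n} (q : CompleteType n) {φ} → (∀ a → a ⊩ᶜ φ) → params φ ⊆ᵖ dom q →
                φ ∈ formulas q
    ⇒sentence q {φ} valid over with complete q φ over
    ... | inj₁ φ∈ = φ∈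
    ... | inj₂ ¬φ∈ with consistent q (_ ∷ []) (¬φ∈ ∷ [])
    ...   | b , b¬φ ∷ [] = contradiction (valid b) (lower ∘ b¬φ)

    -- Enumerations of small sets.

    Cover : Set s → Subset → Set (s ⊔ m)
    Cover I A = Σ[ f ∈ (I → C) ] (∀ {c} → c ∈ A → ∃[ i ] f i ≡ c)

    Enumeration : Set s → Subset → Set (s ⊔ m)
    Enumeration I A = Σ[ f ∈ (I → C) ] (∀ i → f i ∈ A) × (∀ {c} → c ∈ A → ∃[ i ] f i ≡ c)

    -- Indices that belong to no element of A are mapped to point.
    cover : ∀ {A I} → A ≼ I → Cover I A
    cover {A} {I} inj = (λ i → choose point (At i)) , λ {c} c∈ →
        let i = Injection.to inj (c , c∈)
            c∈′ , eq = choose-spec point (At i) (c , c∈ , refl)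
        in i , Injection.injective inj {choose point (At i) , c∈′} {c , c∈} eq
      where
      At : I → C → Set _
      At i c = Σ[ c∈ ∈ c ∈ A ] Injection.to inj (c , c∈) ≡ i

    cover⇒small : ∀ {A I} → Cover I A → Small A
    cover⇒small {A} {I} (f , cov) = I , record
      { to        = λ (c , c∈) → indexOf c (truth⁺ (cov c∈))
      ; cong      = λ { {c , _} refl → cong (indexOf c) (uip _ _) }
      ; injective = λ { {c , c∈} {c′ , c∈′} eq →
          trans (sym (indexOf-spec c (truth⁺ (cov c∈))))
                (trans (cong f eq) (indexOf-spec c′ (truth⁺ (cov c∈′)))) }
      }
      where
      -- Passing through Bool makes the index independent of the proof of c ∈ A.
      indexOf : ∀ c → truth (∃[ i ] f i ≡ c) ≡ true → I
      indexOf c = proj₁ ∘ truth⁻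

      indexOf-spec : ∀ c p → f (indexOf c p) ≡ c
      indexOf-spec c = proj₂ ∘ truth⁻

      uip : ∀ {b c : Bool} (p q : b ≡ c) → p ≡ q
      uip refl refl = refl

    enumerate : ∀ {A} → Small A → Σ[ I ∈ Set s ] Enumeration I A
    enumerate {A} (κ , A≼κ) = let f , cov = cover A≼κ in
      -- A cover may take values outside `A`, and those indices are removed. The condition passes
      -- through Bool because membership in `A` is in `Set m`, while the index set must be in
      -- `Set s`.
      (Σ[ i ∈ κ ] truth (f i ∈ A) ≡ true) , f ∘ proj₁ , truth⁻ ∘ proj₂ ,
      λ {c} c∈ → let i , eq = cov c∈ in (i , truth⁺ (subst A (sym eq) c∈)) , eq

    -- Dividing from many extensions

    module Homogeneous {n} {κ M : Set s} (q : κ → CompleteType n) (d : κ → M → C)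
             (covers : ∀ i {c} → c ∈ dom (q i) → ∃[ x ] d i x ≡ c)
             {k} (kinc : KInconsistent (suc k) (formulas ∘ q)) where

      _∈[_] : Template L M n → κ → Set m
      t ∈[ i ] = inst (d i) t ∈ formulas (q i)

      -- A template does not record which type supplied it, so in the second part it is read in
      -- every listed type that contains it. Thus a witness makes no reference to indices and can
      -- serve as a colour.
      Witness : List κ → List (Template L M n) → Set _
      Witness l ts = All (λ t → ∃[ i ] i ∈ˡ l × t ∈[ i ]) ts ×
                     (∀ a → ¬ All (λ t → ∀ {i} → i ∈ˡ l → t ∈[ i ] → a ⊩ᶜ inst (d i) t) ts)

      template : ∀ {i φ} → φ ∈ formulas (q i) → ∃[ t ] inst (d i) t ≡ φ
      template {i} {φ ⟨ c ⟩} φ∈ = let cov = λ j → covers i (over-dom (q i) φ∈ j) in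
        φ ⟨ proj₁ ∘ cov ⟩ᵗ , cong (φ ⟨_⟩) (ext (proj₂ ∘ cov))

      witness : ∀ {l} → Unique l → length l ≡ suc k → ∃ (Witness l)
      witness {l} u len =
        let φs , φs⊆ , inc = kInconsistent⇒ kinc u len
            ts , ts⊆ , k   = templates φs⊆
        in ts , ts⊆ , λ a ats → inc a (k ats)
        where
        templates : ∀ {φs} → All (λ φ → ∃[ i ] i ∈ˡ l × φ ∈ formulas (q i)) φs →
          ∃[ ts ] All (λ t → ∃[ i ] i ∈ˡ l × t ∈[ i ]) ts ×
            (∀ {a} → All (λ t → ∀ {i} → i ∈ˡ l → t ∈[ i ] → a ⊩ᶜ inst (d i) t) ts →
                     All (a ⊩ᶜ_) φs)
        templates [] = [] , [] , λ _ → []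
        templates ((i , i∈ , φ∈) ∷ φs⊆) with template φ∈ | templates φs⊆
        ... | t , refl | ts , ts⊆ , k =
          t ∷ ts , (i , i∈ , φ∈) ∷ ts⊆ , λ { (at ∷ ats) → at i∈ φ∈ ∷ k ats }

      profile : List κ → Template L M n → Bool
      profile []      _ = false
      profile (i ∷ _) t = truth (t ∈[ i ])

      colour : List κ → List (Template L M n) × (Template L M n → Bool)
      colour l = choose [] (Witness l) , profile l

      module _ (h : ℕ → κ) (h-inj : Injective _≡_ _≡_ h) {γ}
               (hom : ∀ {l} → Descending _<_ l → length l ≡ suc k → colour (map h l) ≡ γ) where

        -- The shift makes every index the head of a descending list of length k + 1.
        g : ℕ → κ
        g j = h (j + k)

        g-injective : Injective _≡_ _≡_ g
        g-injective eq = ℕ.+-cancelʳ-≡ k _ _ (h-inj eq)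

        initial : ℕ → List ℕ
        -- The list runs from `j + k` down to `j`, so `h` sends its head to `g j`.
        initial j = applyDownFrom (j +_) (suc k)

        initial-descending : ∀ j → Descending _<_ (initial j)
        initial-descending j =
          AllPairs.applyDownFrom⁺₁ (j +_) (suc k) λ i<i′ _ → ℕ.+-monoʳ-< j i<i′

        transfer : ∀ i j {t} → t ∈[ g i ] → t ∈[ g j ]
        transfer i j {t} t∈ = truth⁻ (trans (sym (same j)) (trans (same i) (truth⁺ t∈)))
          where
          same : ∀ j → proj₂ γ t ≡ truth (t ∈[ g j ])
          same j = cong (λ z → proj₂ z t)
            (sym (hom (initial-descending j) (length-applyDownFrom (j +_) (suc k))))

        ts : List (Template L M n)
        ts = proj₁ γ

        -- The first component of the colour is itself a chosen witness; being constant, it is a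
        -- witness for all these lists at once.
        ts-witness : ∀ {l} → Descending _<_ l → length l ≡ suc k → Witness (map g l) ts
        ts-witness {l} desc len = subst (Witness (map g l)) eq
          (choose-spec [] (Witness (map g l)) (witness
            (Unique.map⁺ g-injective (AllPairs.map (λ y<x → ℕ.<⇒≢ y<x ∘ sym) desc))
            (trans (length-map g l) len)))
          where
          shifted : Descending _<_ (map (_+ k) l)
          shifted = AllPairs.map⁺ (AllPairs.map (ℕ.+-monoˡ-< k) desc)

          eq : choose [] (Witness (map g l)) ≡ ts
          eq = trans (cong (λ l → choose [] (Witness l)) (map-∘ l))
                 (cong proj₁ (hom shifted (trans (length-map (_+ k) l) len)))

        ts-member : All (λ t → ∀ i → t ∈[ g i ]) ts
        ts-member = All.map (λ { (_ , i∈ , t∈) i → at (∈-map⁻ g i∈) t∈ i })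
          (proj₁ (ts-witness (initial-descending 0) (length-applyDownFrom (0 +_) (suc k))))
          where
          at : ∀ {x l t} → ∃[ j ] j ∈ˡ l × x ≡ g j → t ∈[ x ] → ∀ i → t ∈[ g i ]
          at (j , _ , refl) t∈ i = transfer j i t∈

        conjunction : Template L M n
        conjunction = ¬ᵗ (ts ⇛ falsumᵗ)

        ⊩-conjunction : ∀ i a → a ⊩ᶜ inst (d (g i)) conjunction ⇔
                                All (λ t → a ⊩ᶜ inst (d (g i)) t) ts
        ⊩-conjunction i a = mk⇔
          (λ ¬ts → dne λ ¬all → lower (¬ts (Equivalence.from ts⇒⊥ λ all → contradiction all ¬all)))
          (λ all p → Equivalence.to ts⇒⊥ p all)
          where ts⇒⊥ = ⊩-⇛ (d (g i)) a ts falsumᵗ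

        conjunction-over : ∀ i → Over (λ x → d (g i) x ∈ dom (q (g i))) conjunction
        conjunction-over i = ⇛-over (λ x → d (g i) x ∈ dom (q (g i))) falsumᵗ
          (All.map (λ t∈ → over-dom (q (g i)) (t∈ i)) ts-member) λ ()

        kInconsistent : KInconsistent (suc k) (λ i → ｛ inst (d (g i)) conjunction ｝)
        kInconsistent ι ι-inj con =
          let φ : ℕ → ParamFormula n
              φ i = inst (d (g i)) conjunction
              -- Homogeneity is known for descending lists only, so the given indices are sorted
              -- first.
              l , desc , l↭ = sortDescending ℕ.<-isStrictTotalOrder (Unique.tabulate⁺ {f = ι} ι-inj)
              a , aφs = con (map φ l) (All.map⁺ (All.tabulate λ i∈ →
                let x , eq = ∈-tabulate⁻ {f = ι} (∈-resp-↭ l↭ i∈) in x , cong φ (sym eq)))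
              conj : ∀ {i} → i ∈ˡ l → All (λ t → a ⊩ᶜ inst (d (g i)) t) ts
              conj i∈ = Equivalence.to (⊩-conjunction _ a) (All.lookup (All.map⁻ aφs) i∈)
          in proj₂ (ts-witness desc (trans (↭-length l↭) (length-tabulate ι))) a
               (All.tabulate λ {t} t∈ x∈ _ → holds {a} {t} (∈-map⁻ g x∈) λ i∈ → All.lookup (conj i∈) t∈)
          where
          holds : ∀ {a t x l} → ∃[ j ] j ∈ˡ l × x ≡ g j →
                  (∀ {i} → i ∈ˡ l → a ⊩ᶜ inst (d (g i)) t) → a ⊩ᶜ inst (d x) t
          holds (j , j∈ , refl) f = f j∈

        divides : ∀ {A} {I : Set s} (e : I → M) (a : I → C) → (∀ {c} → c ∈ A → ∃[ x ] a x ≡ c) →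
                  (∀ i x → d i (e x) ≡ a x) → (∀ i → A ⊆ dom (q i)) → Divides (q (g 0)) A
        divides {A} e a a-covers d-e A⊆ = inst (d (g 0)) conjunction ,
          ⇒implies {φ = inst (d (g 0)) conjunction} (map (inst (d (g 0))) ts)
            (All.map⁺ (All.map (λ t∈ → t∈ 0) ts-member))
            (λ {v} → Equivalence.from (⊩-conjunction 0 v) ∘ All.map⁻) ,
          suc k , (λ i → d (g i) ∘ pos) , sameType , kInconsistent
          where
          pos = params conjunction

          -- The constants of ψ from `A` sit at positions `u` that have the same value for every
          -- index. So ψ about the parameters is the instance of one template `t` without the
          -- variables of the type; its truth is membership in `q (g i)`, which `transfer` makes
          -- independent of `i`.
          sameType : ∀ i → SameType A (d (g 0) ∘ pos) (d (g i) ∘ pos)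
          sameType i (_⟨_⟩ {r} ψ c) c∈ = mk⇔ (move 0 i) (move i 0)
            where
            u : Fin r → M
            u x = e (proj₁ (a-covers (c∈ x)))

            u-eq : ∀ j → d j ∘ u ≡ c
            u-eq j = ext λ x → trans (d-e j _) (proj₂ (a-covers (c∈ x)))

            t : Template L M n
            t = rename (n ↑ʳ_) ψ ⟨ pos ++ u ⟩ᵗ

            meaning : ∀ j v → (v ⊩ᶜ inst (d (g j)) t) ≡ (ψ ⊨[ (d (g j) ∘ pos) ++ c ])
            meaning j v = trans (⊨-rename (n ↑ʳ_) ψ _) (cong (ψ ⊨[_])
              (trans (++-↑ʳ v _)
                (trans (∘-++ (d (g j)) pos u) (cong ((d (g j) ∘ pos) ++_) (u-eq (g j))))))

            t-over : ∀ j → params (inst (d (g j)) t) ⊆ᵖ dom (q (g j))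
            t-over j x with splitAt (arity conjunction) x
            ... | inj₁ y = conjunction-over j y
            ... | inj₂ y = subst (_∈ dom (q (g j))) (sym (cong (λ f → f y) (u-eq (g j))))
                             (A⊆ (g j) (c∈ y))

            move : ∀ i j → ψ ⊨[ (d (g i) ∘ pos) ++ c ] → ψ ⊨[ (d (g j) ∘ pos) ++ c ]
            move i j ψi = subst id (meaning j (const point)) (sentence⇒ (q (g j))
              (λ {a} {b} → subst id (trans (meaning j a) (sym (meaning j b))))
              (transfer i j {t} (⇒sentence (q (g i)) (λ v → subst id (sym (meaning i v)) ψi) (t-over i)))
              (const point))

    -- The formula c ≐ c, with c as a parameter, belongs to a type exactly when c lies in its
    -- domain.
    dom-mono : ∀ {n} {p q : CompleteType n} → p ⊑ q → dom p ⊆ dom q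
    dom-mono {n} {p} {q} p⊑q {c} c∈ =
      over-dom q {c≐c} (p⊑q {c≐c} (⇒sentence p {c≐c} (λ _ → refl) (const c∈))) zero
      where
      c≐c : ParamFormula n
      c≐c = (var (n ↑ʳ zero) ≐ var (n ↑ʳ zero)) ⟨ const {B = Fin 1} c ⟩

    -- Positions in `μ` name elements of `dom (q i)`, which vary with `i`; positions in `I` name
    -- those of `dom p`, which do not. As `μ` is given before `κ`, the Erdős-Rado cardinal for
    -- colours over `μ ⊎ I` can be requested.
    manyExtensions⇒dividingExtension : ∀ o {n P} (p : CompleteType n) →
      SU.ManyExtensions o ℭ n P p → SU.DividingExtension o ℭ n P p
    manyExtensions⇒dividingExtension o {n} {P} p (suc k , _ , μ , many) =
      extract (proj₂ (enumerate (small p))) (erdősRado (suc k) _)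
      where
      Colour : Set s → Set s
      Colour M = List (Template L M n) × (Template L M n → Bool)

      extract : ∀ {I} → Enumeration I (dom p) →
                Σ[ κ ∈ Set s ] HasHomogeneous (suc k) κ (Colour (μ ⊎ I)) →
                SU.DividingExtension o ℭ n P p
      extract {I} (a , _ , a-covers) (κ , homogeneous) = found (homogeneous colour)
        where
        q     = proj₁ (many κ)
        kinc  = proj₁ (proj₂ (proj₂ (many κ)))
        props = proj₂ (proj₂ (proj₂ (many κ)))

        cov : ∀ i → Cover μ (dom (q i))
        cov i = cover (proj₁ (proj₂ (props i)))

        d : κ → μ ⊎ I → C
        d i = [ proj₁ (cov i) , a ]′

        d-covers : ∀ i {c} → c ∈ dom (q i) → ∃[ x ] d i x ≡ c
        d-covers i c∈ = let x , eq = proj₂ (cov i) c∈ in inj₁ x , eq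

        open Homogeneous q d d-covers kinc

        found : Σ[ h ∈ (ℕ → κ) ] Injective _≡_ _≡_ h ×
                  ∃[ γ ] (∀ {l} → Descending _<_ l → length l ≡ suc k → colour (map h l) ≡ γ) →
                SU.DividingExtension o ℭ n P p
        found (h , h-inj , γ , hom) = q (h k) , (proj₁ (props (h k)) ,
          divides h h-inj hom inj₂ a a-covers (λ _ _ → refl)
            (λ i → dom-mono {p = p} {q i} (proj₁ (props i)))) ,
          proj₂ (proj₂ (props (h k)))

    -- Automorphisms

    _·_ : ∀ {n} → (C → C) → ParamFormula n → ParamFormula n
    f · (φ ⟨ c ⟩) = φ ⟨ f ∘ c ⟩

    ·-id : ∀ {n} {f : C → C} (φ : ParamFormula n) → (∀ i → f (params φ i) ≡ params φ i) → f · φ ≡ φ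
    ·-id (φ ⟨ c ⟩) eq = cong (φ ⟨_⟩) (ext eq)

    module Action (σ : Automorphism) where
      open Automorphism σ using (bijection; to; preserves-fun; preserves-rel)
      from = Inverse.from bijection

      to-from : ∀ c → to (from c) ≡ c
      to-from = Inverse.strictlyInverseˡ bijection

      from-to : ∀ c → from (to c) ≡ c
      from-to = Inverse.strictlyInverseʳ bijection

      to-injective : ∀ {x y} → to x ≡ to y → x ≡ y
      to-injective eq = trans (sym (from-to _)) (trans (cong from eq) (from-to _))

      from-injective : ∀ {x y} → from x ≡ from y → x ≡ y
      from-injective eq = trans (sym (to-from _)) (trans (cong to eq) (to-from _))

      ⟦⟧-to : ∀ {n} t (v : Vector C n) → ⟦ ℭ ⟧ t (to ∘ v) ≡ to (⟦ ℭ ⟧ t v)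
      ⟦⟧-to (var i)    v = refl
      ⟦⟧-to (app f ts) v = trans (cong (funᴹ f) (ext λ i → ⟦⟧-to (ts i) v)) (sym (preserves-fun f _))

      ⊨-to : ∀ {n} φ (v : Vector C n) → φ ⊨[ v ] ⇔ φ ⊨[ to ∘ v ]
      ⊨-to ⊥′         v = mk⇔ (λ ()) (λ ())
      ⊨-to (t ≐ u)    v = mk⇔
        (λ p → trans (⟦⟧-to t v) (trans (cong to p) (sym (⟦⟧-to u v))))
        (λ p → to-injective (trans (sym (⟦⟧-to t v)) (trans p (⟦⟧-to u v))))
      ⊨-to (rel R ts) v = subst (λ w → relᴹ R (λ i → ⟦ ℭ ⟧ (ts i) v) ⇔ relᴹ R w)
        (sym (ext λ i → ⟦⟧-to (ts i) v)) (preserves-rel R _)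
      ⊨-to (φ ⇒′ ψ)   v = mk⇔
        (λ f → Equivalence.to (⊨-to ψ v) ∘ f ∘ Equivalence.from (⊨-to φ v))
        (λ f → Equivalence.from (⊨-to ψ v) ∘ f ∘ Equivalence.to (⊨-to φ v))
      ⊨-to (∀′ φ)     v = mk⇔
        (λ f a → subst (φ ⊨[_]) (ext λ { zero → to-from a ; (suc _) → refl })
                   (Equivalence.to (⊨-to φ _) (f (from a))))
        (λ f a → Equivalence.from (⊨-to φ _)
                   (subst (φ ⊨[_]) (ext λ { zero → refl ; (suc _) → refl }) (f (to a))))

      ⊩-to : ∀ {n} {a : Vector C n} φ → a ⊩ᶜ φ → (to ∘ a) ⊩ᶜ (to · φ)
      ⊩-to {a = a} (φ ⟨ c ⟩) = subst (φ ⊨[_]) (∘-++ to a c) ∘ Equivalence.to (⊨-to φ (a ++ c))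

      ⊩-from : ∀ {n} {a : Vector C n} φ → a ⊩ᶜ φ → (from ∘ a) ⊩ᶜ (from · φ)
      ⊩-from {a = a} (φ ⟨ c ⟩) aφ = Equivalence.from (⊨-to φ _)
        (subst (φ ⊨[_]) (sym (trans (∘-++ to (from ∘ a) (from ∘ c))
          (cong₂ _++_ (ext λ i → to-from (a i)) (ext λ i → to-from (c i))))) aφ)

      to·from : ∀ {n} (φ : ParamFormula n) → to · (from · φ) ≡ φ
      to·from φ = ·-id {f = to ∘ from} φ λ i → to-from (params φ i)

      from·to : ∀ {n} (φ : ParamFormula n) → from · (to · φ) ≡ φ
      from·to φ = ·-id {f = from ∘ to} φ λ i → from-to (params φ i)

      All-to : ∀ {n} {a : Vector C n} {φs} → All (a ⊩ᶜ_) (map (from ·_) φs) → All ((to ∘ a) ⊩ᶜ_) φs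
      All-to = All.map (λ {φ} → subst (_ ⊩ᶜ_) (to·from φ) ∘ ⊩-to (from · φ)) ∘ All.map⁻

      All-from : ∀ {n} {a : Vector C n} {φs} → All (a ⊩ᶜ_) (map (to ·_) φs) → All ((from ∘ a) ⊩ᶜ_) φs
      All-from = All.map (λ {φ} → subst (_ ⊩ᶜ_) (from·to φ) ∘ ⊩-from (to · φ)) ∘ All.map⁻

      consistent-from : ∀ {n} {Γ : Pred (ParamFormula n) ℓ} {Δ : Pred (ParamFormula n) ℓ′} →
                        (∀ {φ} → φ ∈ Γ → (to · φ) ∈ Δ) → Consistent Δ → Consistent Γ
      consistent-from Γ⊆Δ con φs φs⊆ =
        let a , aφs = con (map (to ·_) φs) (All.map⁺ (All.map Γ⊆Δ φs⊆)) in
        from ∘ a , All-from aφs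

      -- Membership is tested after pulling back by `from`, so the conditions on domain and
      -- completeness are those of `q`.
      push : ∀ {n} → CompleteType n → CompleteType n
      push q = record
        { dom        = λ c → from c ∈ dom q
        ; small      = proj₁ (small q) , push-small (proj₂ (small q))
        ; formulas   = λ φ → (from · φ) ∈ formulas q
        ; over-dom   = over-dom q
        ; consistent = λ φs φs⊆ → let a , aφs = consistent q (map (from ·_) φs) (All.map⁺ φs⊆) in
                         to ∘ a , All-to aφs
        ; complete   = λ φ → complete q (from · φ)
        }
        where
        push-small : ∀ {A κ} → A ≼ κ → (A ∘ from) ≼ κ
        push-small inj = record
          { to        = λ (c , c∈) → Injection.to inj (from c , c∈)
          ; cong      = λ { {x , x∈} {y , y∈} eq →
              Injection.cong inj {from x , x∈} {from y , y∈} (cong from eq) }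
          ; injective = λ { {x , x∈} {y , y∈} eq →
              from-injective (Injection.injective inj {from x , x∈} {from y , y∈} eq) }
          }

      push-divides : ∀ {n} {q : CompleteType n} {A} → Divides q A → Divides (push q) (A ∘ from)
      push-divides {q = q} {A} (φ ⟨ b ⟩ , imp , k , b′ , same , kinc) =
        φ ⟨ to ∘ b ⟩ ,
        (λ con → imp (consistent-from {Γ = formulas q ∪ ｛ ¬ᶜ (φ ⟨ b ⟩) ｝}
          (λ { {ψ} (inj₁ ψ∈) → inj₁ (subst (_∈ formulas q) (sym (from·to ψ)) ψ∈)
             ; (inj₂ refl)   → inj₂ refl }) con)) ,
        k , (λ i → to ∘ b′ i) ,
        (λ i ψ ψ-over → let e = same i (from · ψ) ψ-over in mk⇔
          (back ψ ∘ Equivalence.to e ∘ forth ψ) (back ψ ∘ Equivalence.from e ∘ forth ψ)) ,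
        λ ι ι-inj con → kinc ι ι-inj (consistent-from {Γ = ⋃ (Fin k) λ i → ｛ φ ⟨ b′ (ι i) ⟩ ｝}
          (λ { (i , refl) → i , refl }) con)
        where
        forth : ∀ {r} {v : Vector C r} ψ → (to ∘ v) ⊩ᶜ ψ → v ⊩ᶜ (from · ψ)
        forth {v = v} ψ p = subst (_⊩ᶜ (from · ψ)) (ext λ i → from-to (v i)) (⊩-from ψ p)

        back : ∀ {r} {v : Vector C r} ψ → v ⊩ᶜ (from · ψ) → (to ∘ v) ⊩ᶜ ψ
        back ψ p = subst (_ ⊩ᶜ_) (to·from ψ) (⊩-to (from · ψ) p)

      push-Rᵈ : ∀ {n} {p q : CompleteType n} → p Rᵈ q → push p Rᵈ push q
      push-Rᵈ {p = p} {q} (p⊑q , div) = p⊑q , push-divides {q = q} {dom p} div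

    -- Only the positions with values in I become parameters: the positions with
    -- values in b cannot be filled by dummy elements of A when A is empty.
    separate : ∀ {r k} {I : Set s} (ι : Fin k → Lift s (Fin r) ⊎ I) →
      ∃[ l ] Σ[ pos ∈ (Fin l → I) ] Σ[ f ∈ (Fin k → Fin (r + l)) ]
        (∀ (b : Vector C r) a → [ b ∘ lower , a ]′ ∘ ι ≡ (b ++ (a ∘ pos)) ∘ f)
    separate {k = zero} ι = 0 , (λ ()) , (λ ()) , λ _ _ → ext λ ()
    separate {r} {suc k} ι with separate (ι ∘ suc) | ι zero in eq
    ... | l , pos , f , f-eq | inj₁ (lift x) = l , pos , (x ↑ˡ l) Vector.∷ f ,
      λ b a → ext λ { zero    → trans (cong [ b ∘ lower , a ]′ eq)
                                  (sym (cong (λ v → v x) (++-↑ˡ b (a ∘ pos))))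
                    ; (suc i) → cong (λ v → v i) (f-eq b a) }
    ... | l , pos , f , f-eq | inj₂ y =
      suc l , y Vector.∷ pos , (r ↑ʳ zero) Vector.∷ (Fin.lift r suc ∘ f) ,
      λ b a → ext λ { zero    → trans (cong [ b ∘ lower , a ]′ eq)
                                  (sym (cong (λ v → v zero) (++-↑ʳ b (a ∘ (y Vector.∷ pos)))))
                    ; (suc i) → trans (cong (λ v → v i) (f-eq b a))
                                  (sym (cong (λ v → v (f i)) (++-lift b (a ∘ (y Vector.∷ pos)) suc))) }

    abstract
      -- The map fixing `A` and sending `b` to `c` is elementary: by `separate`, a formula about
      -- finitely many of its arguments is a formula about `b` with parameters in `A`.
      conjugate : StronglyHomogeneous → ∀ {A} → Small A → ∀ {r} {b c : Vector C r} → SameType A b c →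
        Σ[ σ ∈ Automorphism ] (∀ {e} → e ∈ A → Automorphism.to σ e ≡ e) × Automorphism.to σ ∘ b ≡ c
      conjugate hom {A} A-small {r} {b} {c} same =
        let I , a , a∈ , a-cov = enumerate A-small
            σ , σ-eq = hom (Lift s (Fin r) ⊎ I) [ b ∘ lower , a ]′ [ c ∘ lower , a ]′
              λ φ ι → let l , pos , f , f-eq = separate ι
                          meaning : ∀ b → (b ⊩ᶜ (rename f φ ⟨ a ∘ pos ⟩)) ≡
                                          (φ ⊨[ [ b ∘ lower , a ]′ ∘ ι ])
                          meaning b = trans (⊨-rename f φ _) (cong (φ ⊨[_]) (sym (f-eq b a)))
                      in subst₂ _⇔_ (meaning b) (meaning c) (same (rename f φ ⟨ a ∘ pos ⟩) (a∈ ∘ pos))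
        in σ , (λ e∈ → let i , eq = a-cov e∈ in
                  subst (λ e → Automorphism.to σ e ≡ e) eq (σ-eq (inj₂ i))) ,
           ext λ x → σ-eq (inj₁ (lift x))

    -- Many extensions from dividing

    Eventually : ∀ {r} → (ℕ → Vector C r) → ParamFormula r → Set m
    Eventually b ψ = ∃[ N ] (∀ {j} → N ≤ j → b j ⊩ᶜ ψ)

    -- Saturation realises the average type of the sequence along the ultrafilter. A formula that
    -- holds eventually belongs to it, because its negation holds on a bounded set only.
    limit : Saturated → ∀ {r} (b : ℕ → Vector C r) (B : Pred C ℓ) {I : Set s} (f : I → C) →
            (∀ {c} → c ∈ B → ∃[ i ] f i ≡ c) →
            ∃[ c ] (∀ ψ → (∀ x → params ψ x ∈ B) → Eventually b ψ → c ⊩ᶜ ψ)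
    limit sat {r} b B f f-cov = realise ultrafilter
      where
      realise : Σ[ U ∈ Pred (ℕ → Bool) 0ℓ ] (∀ {l} → All U l → Unbounded l) ×
                  (∀ {S S′} → (∀ j → S j ≡ false → S′ j ≡ true) → U S ⊎ U S′) →
                ∃[ c ] (∀ ψ → (∀ x → params ψ x ∈ B) → Eventually b ψ → c ⊩ᶜ ψ)
      realise (U , unbounded , ultra) = let c , c⊩ = sat r average in
        c , λ ψ over (N , ev) → [ c⊩ {ψ} , (λ (_ , lift U¬ψ) →
          let j , N≤j , ¬ψj = unbounded (U¬ψ ∷ []) N in
          contradiction (ev N≤j) (lower ∘ truth⁻ {P = b j ⊩ᶜ (¬ᶜ ψ)} (All.head ¬ψj))) ]′
          (complete average ψ (lift ∘ truth⁺ ∘ over))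
        where
        S : ParamFormula r → ℕ → Bool
        S ψ j = truth (b j ⊩ᶜ ψ)

        -- `B` may live in a higher universe, as `Available` does; its truth value brings it down to
        -- the level required of a domain.
        B′ : Subset
        B′ c = Lift m (truth (c ∈ B) ≡ true)

        S-¬ : ∀ ψ j → S ψ j ≡ false → S (¬ᶜ ψ) j ≡ true
        S-¬ ψ j eq = truth⁺ λ p → contradiction (trans (sym (truth⁺ p)) eq) λ ()

        average : CompleteType r
        average = record
          { dom        = B′
          ; small      = cover⇒small (f , λ c∈ → f-cov (truth⁻ (lower c∈)))
          ; formulas   = λ ψ → params ψ ⊆ᵖ B′ × Lift m (U (S ψ))
          ; over-dom   = proj₁
          ; consistent = λ φs φs⊆ →
              let j , _ , all = unbounded (All.map⁺ {f = S} (All.map (lower ∘ proj₂) φs⊆)) 0 in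
              b j , All.map truth⁻ (All.map⁻ all)
          ; complete   = λ ψ over → [ (λ u → inj₁ (over , lift u)) , (λ u → inj₂ (over , lift u)) ]′
                           (ultra (S-¬ ψ))
          }

    -- Each term of the transfinite sequence c behaves over the sequence b and
    -- the earlier terms of c as the terms of b do in the limit.
    module Morley (sat : Saturated) {r} (b : ℕ → Vector C r) {A} (A-small : Small A) (κ : Set s) where
      open WellOrder (wellOrder κ)

      Available : κ → (κ → Vector C r) → Pred C _
      Available i c e = e ∈ A ⊎ (∃[ j ] ∃[ x ] b j x ≡ e) ⊎ (∃[ j ] j ◁ i × ∃[ x ] c j x ≡ e)

      Limit : κ → (κ → Vector C r) → Vector C r → Set _
      Limit i c y = ∀ ψ → (∀ x → params ψ x ∈ Available i c) → Eventually b ψ → y ⊩ᶜ ψ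

      available-local : ∀ {i c c′} → (∀ {j} → j ◁ i → c j ≡ c′ j) → Available i c ⊆ Available i c′
      available-local eq (inj₁ e∈) = inj₁ e∈
      available-local eq (inj₂ (inj₁ e∈)) = inj₂ (inj₁ e∈)
      available-local eq (inj₂ (inj₂ (j , j◁i , x , p))) =
        inj₂ (inj₂ (j , j◁i , x , trans (cong (λ v → v x) (sym (eq j◁i))) p))

      sequence : Σ[ c ∈ (κ → Vector C r) ] (∀ i → Limit i c (c i))
      sequence =
        let c , spec = wfChoose-spec ◁-wf (const point) Limit
                         (λ eq lim ψ over → lim ψ (available-local (sym ∘ eq) ∘ over))
        in c , λ i → spec i (exists i c)
        where
        exists : ∀ i c → ∃ (Limit i c)
        exists i c with enumerate A-small
        ... | I , a , _ , a-cov = limit sat b (Available i c)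
          -- All terms of `c` are listed, not only the earlier ones: a cover suffices, and the
          -- condition `j ◁ i` is too large for an index set in `Set s`.
          {I ⊎ (Lift s (ℕ × Fin r) ⊎ (κ × Fin r))}
          [ a , [ (λ (lift (j , x)) → b j x) , (λ (j , x) → c j x) ]′ ]′
          λ { (inj₁ e∈) → let i , eq = a-cov e∈ in inj₁ i , eq
            ; (inj₂ (inj₁ (j , x , eq))) → inj₂ (inj₁ (lift (j , x))) , eq
            ; (inj₂ (inj₂ (j , _ , x , eq))) → inj₂ (inj₂ (j , x)) , eq }

      module _ (c : κ → Vector C r) (c-limit : ∀ i → Limit i c (c i)) where

        sameType : ∀ {b₀} → (∀ j → SameType A b₀ (b j)) → ∀ i → SameType A b₀ (c i)
        sameType {b₀} same i ψ over = mk⇔ (forward ψ over) λ cψ → dne λ ¬b₀ψ →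
            lower (forward (¬ᶜ ψ) over (λ b₀ψ → contradiction b₀ψ ¬b₀ψ) cψ)
          where
          forward : ∀ ψ → params ψ ⊆ᵖ A → b₀ ⊩ᶜ ψ → c i ⊩ᶜ ψ
          forward ψ over b₀ψ =
            c-limit i ψ (inj₁ ∘ over) (0 , λ {j} _ → Equivalence.to (same j ψ over) b₀ψ)

        module _ {n} (φ : Formula L (n + r)) {k} (kinc : KInconsistent k (λ j → ｛ φ ⟨ b j ⟩ ｝)) where

          -- In variables x, y, `atᵗ e` is φ(x,e), where y does not occur, and `freeᵗ` is φ(x,y).
          atᵗ : Vector C r → Template L C (n + r)
          atᵗ e = rename (_++_ {m = n} (λ i → (i ↑ˡ r) ↑ˡ r) ((n + r) ↑ʳ_)) φ ⟨ e ⟩ᵗ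

          ⊩-atᵗ : ∀ (x : Vector C n) (y e : Vector C r) →
                  ((x ++ y) ⊩ᶜ inst id (atᵗ e)) ≡ (x ⊩ᶜ (φ ⟨ e ⟩))
          ⊩-atᵗ x y e = trans (⊨-rename _ φ _) (cong (φ ⊨[_])
            (trans (∘-++ ((x ++ y) ++ e) (λ i → (i ↑ˡ r) ↑ˡ r) ((n + r) ↑ʳ_))
              (cong₂ _++_ (trans (cong (_∘ (_↑ˡ r)) (++-↑ˡ (x ++ y) e)) (++-↑ˡ x y))
                          (++-↑ʳ (x ++ y) e))))

          freeᵗ : Template L C (n + r)
          freeᵗ = rename (_↑ˡ 0) φ ⟨ Vector.[] ⟩ᵗ

          ⊩-freeᵗ : ∀ (x : Vector C n) (y : Vector C r) →
                    ((x ++ y) ⊩ᶜ inst id freeᵗ) ≡ (x ⊩ᶜ (φ ⟨ y ⟩))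
          ⊩-freeᵗ x y = trans (⊨-rename (_↑ˡ 0) φ _)
            (cong (φ ⊨[_]) (++-↑ˡ (x ++ y) (id ∘ Vector.[])))

          -- This is ∀x (φ(x,e₁) → ... → φ(x,eₘ) → ¬φ(x,y)), a formula in y to which the limit
          -- property of the sequence applies.
          excludedBy : List (Vector C r) → Template L C r
          excludedBy es = ∀ᵗ n (map atᵗ es ⇛ (¬ᵗ freeᵗ))

          ⊩-excludedBy : ∀ y es → y ⊩ᶜ inst id (excludedBy es) ⇔
                         (∀ x → All (λ e → x ⊩ᶜ (φ ⟨ e ⟩)) es → ¬ (x ⊩ᶜ (φ ⟨ y ⟩)))
          ⊩-excludedBy y es = mk⇔
            (λ p x xes xy → lower (Equivalence.to (⊩-⇛ id (x ++ y) (map atᵗ es) (¬ᵗ freeᵗ))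
              (Equivalence.to (⊩-∀ᵗ id n y (map atᵗ es ⇛ (¬ᵗ freeᵗ))) p x)
              (All.map⁺ (All.map (λ {e} → subst id (sym (⊩-atᵗ x y e))) xes))
              (subst id (sym (⊩-freeᵗ x y)) xy)))
            (λ f → Equivalence.from (⊩-∀ᵗ id n y (map atᵗ es ⇛ (¬ᵗ freeᵗ))) λ x →
              Equivalence.from (⊩-⇛ id (x ++ y) (map atᵗ es) (¬ᵗ freeᵗ)) λ all xy →
              lift (f x (All.map (λ {e} → subst id (⊩-atᵗ x y e)) (All.map⁻ all))
                        (subst id (⊩-freeᵗ x y) xy)))

          fresh : ∀ js → ∃[ N ] (∀ {j} → N ≤ j → All (j ≢_) js)
          fresh []       = 0 , λ _ → []
          fresh (j ∷ js) = let N , f = fresh js in suc j ⊔ⁿ N , λ N≤ →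
            ℕ.<⇒≢ (ℕ.m⊔n≤o⇒m≤o (suc j) N N≤) ∘ sym ∷ f (ℕ.m⊔n≤o⇒n≤o (suc j) N N≤)

          -- The ◁-largest cᵢ satisfies the formula excludedBy es because bⱼ does,
          -- by induction, for all j outside js.
          mixed : ∀ {is js} → Descending _◁_ is → Unique js → length is + length js ≡ k → ∀ x →
                  All (λ i → x ⊩ᶜ (φ ⟨ c i ⟩)) is → ¬ All (λ j → x ⊩ᶜ (φ ⟨ b j ⟩)) js
          mixed {[]} [] u len x _ xjs =
            let φs , φs⊆ , inc = kInconsistent⇒ {Γ = λ j → ｛ φ ⟨ b j ⟩ ｝} kinc u len in
            inc x (All.map (λ { (j , j∈ , refl) → All.lookup xjs j∈ }) φs⊆)
          mixed {i ∷ is} {js} (is◁i ∷ desc) u len x (xi ∷ xis) xjs =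
            Equivalence.to (⊩-excludedBy (c i) es) (c-limit i (inst id (excludedBy es)) es-over
              (let N , fr = fresh js in N , λ {j} N≤j →
                Equivalence.from (⊩-excludedBy (b j) es) λ x xes xj → mixed
                  desc (fr N≤j ∷ u) (trans (ℕ.+-suc (length is) (length js)) len) x
                  (All.map⁻ (All.++⁻ˡ (map c is) xes)) (xj ∷ All.map⁻ (All.++⁻ʳ (map c is) xes))))
              x (All.++⁺ (All.map⁺ xis) (All.map⁺ xjs)) xi
            where
            es : List (Vector C r)
            es = map c is ++ˡ map b js

            earlier-over : ∀ {j} → j ◁ i → Over (Available i c) (atᵗ (c j))
            earlier-over j◁i y = inj₂ (inj₂ (_ , j◁i , y , refl))

            base-over : ∀ j → Over (Available i c) (atᵗ (b j))
            base-over j y = inj₂ (inj₁ (j , y , refl))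

            es-over : Over (Available i c) (excludedBy es)
            es-over = ∀ᵗ-over (Available i c) n (map atᵗ es ⇛ (¬ᵗ freeᵗ))
              (⇛-over (Available i c) (¬ᵗ freeᵗ)
                (All.map⁺ (All.++⁺ (All.map⁺ (All.map earlier-over is◁i))
                                   (All.map⁺ (All.tabulate λ {j} _ → base-over j))))
                λ ())

          inconsistent : ∀ {is} → Unique is → length is ≡ k → ∀ x → ¬ All (λ i → x ⊩ᶜ (φ ⟨ c i ⟩)) is
          inconsistent {is} u len x xis =
            let is′ , desc , is′↭ = sortDescending ◁-sto u in
            mixed desc [] (trans (ℕ.+-identityʳ _) (trans (↭-length is′↭) len)) x
              (All-resp-↭ (↭-sym is′↭) xis) []

    kInconsistent-suc : ∀ {n k} {I : Set a} {Γ : I → Pred (ParamFormula n) ℓ} →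
                        KInconsistent k Γ → KInconsistent (suc k) Γ
    kInconsistent-suc kinc ι ι-inj con = kinc (ι ∘ suc) (Fin.suc-injective ∘ ι-inj) λ φs φs⊆ →
      con φs (All.map (λ (i , φ∈) → suc i , φ∈) φs⊆)

    dividingExtension⇒manyExtensions : Saturated → StronglyHomogeneous →
      ∀ o {n P} (p : CompleteType n) → (∀ σ q → q ∈ P → Action.push σ q ∈ P) →
      SU.DividingExtension o ℭ n P p → SU.ManyExtensions o ℭ n P p
    dividingExtension⇒manyExtensions sat homogeneous o {n} {P} p invariant
      (q , (p⊑q , φ ⟨ b₀ ⟩ , imp , k , b , same , kinc) , q∈P) =
      -- Dividing allows any `k`; adding two ensures the required lower bound.
      suc (suc k) , s≤s (s≤s z≤n) , proj₁ (small q) ,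
      -- Conjugates along the sequence may coincide, so it is taken long enough for `unrelated` to
      -- select `κ` distinct ones.
      λ κ → let c , c-limit = Morley.sequence sat b (small p) ((κ × ℕ) → Bool) in family κ c
        (Morley.sameType sat b (small p) _ c c-limit same)
        (Morley.inconsistent sat b (small p) _ c c-limit {n} φ
          (kInconsistent-suc {Γ = λ j → ｛ φ ⟨ b j ⟩ ｝} (kInconsistent-suc {Γ = λ j → ｛ φ ⟨ b j ⟩ ｝} kinc)))
      where
      module _ (κ : Set s) (c : ((κ × ℕ) → Bool) → Vector C _)
               (c-same : ∀ i → SameType (dom p) b₀ (c i))
               (c-inc : ∀ {is} → Unique is → length is ≡ suc (suc k) →
                        ∀ x → ¬ All (λ i → x ⊩ᶜ (φ ⟨ c i ⟩)) is) where

        σ : ((κ × ℕ) → Bool) → Automorphism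
        σ i = proj₁ (conjugate homogeneous (small p) (c-same i))

        Q : ((κ × ℕ) → Bool) → CompleteType n
        Q i = Action.push (σ i) q

        extends : ∀ i → p ⊑ Q i
        extends i {ψ} ψ∈ = p⊑q (subst (_∈ formulas p) (sym (·-id {f = from} ψ λ x →
            trans (cong from (sym (fixes (over-dom p ψ∈ x)))) (from-to _))) ψ∈)
          where
          open Action (σ i)
          fixes = proj₁ (proj₂ (conjugate homogeneous (small p) (c-same i)))

        implies : ∀ i → ∃[ φs ] All (_∈ formulas (Q i)) φs ×
                                (∀ {a} → All (a ⊩ᶜ_) φs → a ⊩ᶜ (φ ⟨ c i ⟩))
        implies i =
          let φs , φs⊆ , f = implies⇒ {φ = φ ⟨ b₀ ⟩} imp in
          map (to ·_) φs ,
          All.map⁺ (All.map (λ {ψ} → subst (_∈ formulas q) (sym (from·to ψ))) φs⊆) ,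
          λ {a} aφs → subst (λ v → a ⊩ᶜ (φ ⟨ v ⟩))
            (proj₂ (proj₂ (conjugate homogeneous (small p) (c-same i))))
            (subst (_⊩ᶜ (φ ⟨ to ∘ b₀ ⟩)) (ext λ x → to-from (a x)) (⊩-to (φ ⟨ b₀ ⟩) (f (All-from aφs))))
          where
          open Action (σ i)
          to = Automorphism.to (σ i)

        -- Applied with Γ a single conjugate, this bounds how many conjugates coincide; with Γ a
        -- union of conjugates, it gives inconsistency of the family.
        union-inconsistent : ∀ {is} {Γ : Pred (ParamFormula n) ℓ} → Unique is → length is ≡ suc (suc k) →
                             All (λ i → formulas (Q i) ⊆ Γ) is → ¬ Consistent Γ
        union-inconsistent {is = is} {Γ} u len Q⊆Γ con =
          let φs , φs⊆ , f = collect Q⊆Γ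
              a , aφs = con φs φs⊆
          in c-inc u len a (f aφs)
          where
          collect : ∀ {is} → All (λ i → formulas (Q i) ⊆ Γ) is →
                    ∃[ φs ] All (_∈ Γ) φs ×
                            (∀ {a} → All (a ⊩ᶜ_) φs → All (λ i → a ⊩ᶜ (φ ⟨ c i ⟩)) is)
          collect [] = [] , [] , λ _ → []
          collect {i ∷ _} (Qi⊆ ∷ Q⊆) =
            let φs , φs⊆ , f = implies i
                ψs , ψs⊆ , g = collect Q⊆
            in φs ++ˡ ψs , All.++⁺ (All.map Qi⊆ φs⊆) ψs⊆ ,
               λ aall → f (All.++⁻ˡ φs aall) ∷ g (All.++⁻ʳ φs aall)

        choice : Σ[ g ∈ (κ → (κ × ℕ) → Bool) ] (∀ {i j} → Q (g i) ≈ Q (g j) → i ≡ j)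
        choice = unrelated (λ i j → Q i ≈ Q j) (λ (p , q) → q , p) (suc (suc k))
          λ {x} u Q≈ len →
            union-inconsistent {Γ = formulas (Q x)} u len (All.map proj₁ Q≈) (consistent (Q x))

        family : Σ[ q′ ∈ (κ → CompleteType n) ] Injective _≡_ _≈_ q′ ×
                   KInconsistent (suc (suc k)) (formulas ∘ q′) ×
                   (∀ i → p ⊑ q′ i × dom (q′ i) ≼ proj₁ (small q) × q′ i ∈ P)
        family = let g , g-inj = choice in
          Q ∘ g , g-inj ,
          (λ ι ι-inj → union-inconsistent {is = tabulate (g ∘ ι)}
            (Unique.tabulate⁺ {f = g ∘ ι} λ eq → ι-inj (g-inj (subst (λ x → Q (g (ι _)) ≈ Q x) eq (id , id))))
            (length-tabulate (g ∘ ι)) (All.tabulate⁺ {f = g ∘ ι} λ x φ∈ → x , φ∈)) ,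
          λ i → extends (g i) , proj₂ (small (Q (g i))) , invariant (σ (g i)) q q∈P

    -- The two ranks

    module Ranks (T : Theory L) (monster : IsMonsterModel T) (o : Level) (n : ℕ) where
      open IsMonsterModel monster using (saturated; stronglyHomogeneous)
      open SU o ℭ n
      open Ordinal using () renaming (_<_ to Below)

      -- The conjugates that form the family of extensions get their rank bound from this.
      dividing-invariant : ∀ (W : Ordinal o) {a} (ac : Acc (Below W) a) σ q →
        Dividing.AtLeastPoint W ac q → Dividing.AtLeastPoint W ac (Action.push σ q)
      dividing-invariant W (acc rs) σ q (successor , limit) =
        (λ b b⋖a → let q′ , R , q′∈ = successor b b⋖a in
          Action.push σ q′ , Action.push-Rᵈ σ {p = q} {q′} R ,
          dividing-invariant W (rs (proj₁ b⋖a)) σ q′ q′∈) ,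
        λ a-limit b b<a → dividing-invariant W (rs b<a) σ q (limit a-limit b b<a)

      manyExtensions-mono : ∀ {P Q} p → (∀ q → q ∈ P → q ∈ Q) → ManyExtensions P p → ManyExtensions Q p
      manyExtensions-mono p P⊆Q (k , 2≤k , μ , many) = k , 2≤k , μ , λ κ →
        let q , q-inj , kinc , props = many κ in
        q , q-inj , kinc , λ i →
        let p⊑q , dom≼μ , q∈P = props i in (λ {φ} → p⊑q {φ}) , dom≼μ , P⊆Q (q i) q∈P

      counting⇒dividing : ∀ (W : Ordinal o) {a} (ac : Acc (Below W) a) p →
        Counting.AtLeastPoint W ac p → Dividing.AtLeastPoint W ac p
      counting⇒dividing W (acc rs) p (successor , limit) =
        (λ b b⋖a → manyExtensions⇒dividingExtension o p
          (manyExtensions-mono p (counting⇒dividing W (rs (proj₁ b⋖a))) (successor b b⋖a))) ,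
        λ a-limit b b<a → counting⇒dividing W (rs b<a) p (limit a-limit b b<a)

      -- The bound on the extensions is converted only after the conjugates are formed, since
      -- invariance is established for the rank defined by dividing.
      dividing⇒counting : ∀ (W : Ordinal o) {a} (ac : Acc (Below W) a) p →
        Dividing.AtLeastPoint W ac p → Counting.AtLeastPoint W ac p
      dividing⇒counting W (acc rs) p (successor , limit) =
        (λ b b⋖a → manyExtensions-mono p (dividing⇒counting W (rs (proj₁ b⋖a)))
          (dividingExtension⇒manyExtensions saturated stronglyHomogeneous o p
            (dividing-invariant W (rs (proj₁ b⋖a))) (successor b b⋖a))) ,
        λ a-limit b b<a → dividing⇒counting W (rs b<a) p (limit a-limit b b<a)

      atLeast⇔ : ∀ p α → Counting.AtLeast p α ⇔ Dividing.AtLeast p α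
      atLeast⇔ p α = mk⇔ (counting⇒dividing (sucᵒ α) _ p) (dividing⇒counting (sucᵒ α) _ p)

      isSupremum⇔ : ∀ p α → Counting.IsSupremum p α ⇔ Dividing.IsSupremum p α
      isSupremum⇔ p α = mk⇔
        (λ (upper , least) → (λ β → upper β ∘ Equivalence.from (atLeast⇔ p β)) ,
          λ γ bound → least γ λ β → bound β ∘ Equivalence.to (atLeast⇔ p β))
        (λ (upper , least) → (λ β → upper β ∘ Equivalence.to (atLeast⇔ p β)) ,
          λ γ bound → least γ λ β → bound β ∘ Equivalence.from (atLeast⇔ p β))

      hasRank⇔ : ∀ p v → Counting.HasRank p v ⇔ Dividing.HasRank p v
      hasRank⇔ p (just α) = isSupremum⇔ p α
      hasRank⇔ p nothing  = mk⇔
        (λ ∄ (α , α-sup) → ∄ (α , Equivalence.from (isSupremum⇔ p α) α-sup))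
        (λ ∄ (α , α-sup) → ∄ (α , Equivalence.to (isSupremum⇔ p α) α-sup))

mainTheorem2 : (∀ {ℓ} → ExcludedMiddle ℓ) →
    (∀ {a b} → Extensionality a b) →
    ∀ {s m : Level} (o : Level) (L : Language s) (T : Theory L) → IsComplete T →
    (ℭ : Structure L m) → Types.IsMonsterModel ℭ T →
    (n : ℕ) (p : Types.CompleteType ℭ n) →
    (∀ (α : Ordinal o) → SU.Counting.AtLeast o ℭ n p α ⇔ SU.Dividing.AtLeast o ℭ n p α) ×
    (∀ (v : Maybe (Ordinal o)) → SU.Counting.HasRank o ℭ n p v ⇔ SU.Dividing.HasRank o ℭ n p v)
mainTheorem2 em ext o L T _ ℭ monster n p = Ranks.atLeast⇔ p , Ranks.hasRank⇔ p
  where module Ranks = Classical.Logic.Ranks em ext ℭ T monster o n
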